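{- Let $A\in\mathbb{Z}^{d\times n}$ be a matrix with $\operatorname{cone}(A)$ pointed, let $Q$ be the semigroup generated by its columns, $F$ the set of fundamental holes of $Q$, and $S$ the set of saturation points of $Q$. Then \[ S=\bigcap_{f\in F}\bigl[((f+Q)\cap Q)-f\bigr], \] and hence \[ S=\Bigl\{A\lambda \;\Big|\; \lambda\in\mathbb{Z}_+^n,\ x^\lambda\in\bigcap_{f\in F} I_{A,f}\Bigr\}. \]
   Context: Let $\mathbb{Z}_+$ denote the nonnegative integers. $Q=\{A\lambda:\lambda\in\mathbb{Z}_+^n\}$; $\operatorname{cone}(A)=\{A\lambda:\lambda\in\mathbb{R}^n,\ \lambda\ge 0\}$; $\operatorname{lattice}(A)=\{A\lambda:\lambda\in\mathbb{Z}^n\}$; $Q_{\mathrm{sat}}=\operatorname{cone}(A)\cap\operatorname{lattice}(A)$. Standing assumption: $\operatorname{cone}(A)$ is pointed (contains no line). The set of holes of $Q$ is $H=Q_{\mathrm{sat}}\setminus Q$. A hole $h\in H$ is called fundamental if there is no other hole $h'\in H$ ($h'\ne h$) with $h-h'\in Q$; $F$ is the set of fundamental holes. A point $s\in Q$ is a saturation point of $Q$ if $s+Q_{\mathrm{sat}}\subseteq Q$; $S$ is the set of all saturation points. For $f\in F$, the monomial ideal $I_{A,f}\subseteq\mathbb{Q}[x_1,\ldots,x_n]$ is \[ I_{A,f}=\langle x^\lambda:\lambda\in\mathbb{Z}_+^n,\ f+A\lambda\in (f+Q)\cap Q\rangle, \] where $x^\lambda=x_1^{\lambda_1}\cdots x_n^{\lambda_n}$.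 For a set $X$ and vector $f$, $X-f=\{x-f:x\in X\}$. If $F=\emptyset$, the first intersection is understood as $Q$ (the intersection being taken among subsets of $Q$; note each set $((f+Q)\cap Q)-f$ is a subset of $Q$) and the second as the whole ring $\mathbb{Q}[x_1,\ldots,x_n]$. -}

module Defs where

open import Algebra.Bundles using (CommutativeMonoid)
open import Algebra.Bundles.Raw using (RawSemiring)
open import Data.Bool.Base using (if_then_else_)
open import Data.Integer.Base as ℤ using (ℤ; +_)
open import Data.List.Base as List using (List; []; _∷_; _++_; cartesianProductWith)
open import Data.Nat.Base as ℕ using (ℕ)
import Data.Nat.Properties as ℕ
open import Data.Product using (∃; _×_; _,_; proj₁; proj₂)
open import Data.Rational.Base as ℚ using (ℚ; 0ℚ; 1ℚ; ½; ∣_∣)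
import Data.Rational.Properties as ℚ
open import Algebra.Properties.CommutativeSemigroup
  (CommutativeMonoid.commutativeSemigroup ℚ.+-0-commutativeMonoid) using (interchange)
open import Data.Vec.Base as Vec using (Vec; map; zipWith; replicate; foldr′)
open import Data.Vec.Properties using (≡-dec)
open import Data.Vec.Relation.Binary.Pointwise.Inductive using (Pointwise)
open import Data.Vec.Relation.Unary.All using (All)
open import Level using (0ℓ)
open import Relation.Binary.PropositionalEquality
open import Relation.Nullary using (¬_)
open import Relation.Nullary.Decidable using (⌊_⌋)
open import Relation.Unary using (Pred; _∈_; _∉_; _⊆_; _∩_; _⊢_; ⋂)

-- Real numbers: Cauchy sequences of rationals, compared by the setoid
-- equality _≈_ ("the difference tends to 0").

IsCauchy : (ℕ → ℚ) → Set
IsCauchy s = ∀ ε → 0ℚ ℚ.< ε →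
  ∃ λ N → ∀ m n → N ℕ.≤ m → N ℕ.≤ n → ∣ s m ℚ.- s n ∣ ℚ.< ε

record ℝ : Set where
  constructor mkℝ
  field
    seq    : ℕ → ℚ
    cauchy : IsCauchy seq
open ℝ public

infix 4 _≈_ _≤_

_≈_ : ℝ → ℝ → Set
x ≈ y = ∀ ε → 0ℚ ℚ.< ε →
  ∃ λ N → ∀ n → N ℕ.≤ n → ∣ seq x n ℚ.- seq y n ∣ ℚ.< ε

_≤_ : ℝ → ℝ → Set
x ≤ y = ∀ ε → 0ℚ ℚ.< ε →
  ∃ λ N → ∀ n → N ℕ.≤ n → seq x n ℚ.< seq y n ℚ.+ ε

fromℚ : ℚ → ℝ
fromℚ q = mkℝ (λ _ → q) λ ε 0<ε →
  0 , λ _ _ _ _ → subst (ℚ._< ε) (sym (cong ∣_∣ (ℚ.+-inverseʳ q))) 0<ε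

fromℤ : ℤ → ℝ
fromℤ z = fromℚ (z ℚ./ 1)

private
  +-rearrange : ∀ a b c d → (a ℚ.+ b) ℚ.- (c ℚ.+ d) ≡ (a ℚ.- c) ℚ.+ (b ℚ.- d)
  +-rearrange a b c d = trans (cong (a ℚ.+ b ℚ.+_) (ℚ.neg-distrib-+ c d))
    (interchange a b (ℚ.- c) (ℚ.- d))

  telescope : ∀ a b c → a ℚ.- c ≡ (a ℚ.- b) ℚ.+ (b ℚ.- c)
  telescope a b c = sym (begin
    (a ℚ.- b) ℚ.+ (b ℚ.- c)      ≡⟨ ℚ.+-assoc a (ℚ.- b) (b ℚ.- c) ⟩
    a ℚ.+ (ℚ.- b ℚ.+ (b ℚ.- c))  ≡⟨ cong (a ℚ.+_) (ℚ.+-assoc (ℚ.- b) b (ℚ.- c)) ⟨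
    a ℚ.+ ((ℚ.- b ℚ.+ b) ℚ.- c)  ≡⟨ cong (λ z → a ℚ.+ (z ℚ.- c)) (ℚ.+-inverseˡ b) ⟩
    a ℚ.+ (0ℚ ℚ.- c)             ≡⟨ cong (a ℚ.+_) (ℚ.+-identityˡ (ℚ.- c)) ⟩
    a ℚ.- c                      ∎)
    where open ≡-Reasoning

  split : ∀ a b → a ≡ b ℚ.+ (a ℚ.- b)
  split a b = sym (begin
    b ℚ.+ (a ℚ.- b)    ≡⟨ ℚ.+-comm b (a ℚ.- b) ⟩
    (a ℚ.- b) ℚ.+ b    ≡⟨ ℚ.+-assoc a (ℚ.- b) b ⟩
    a ℚ.+ (ℚ.- b ℚ.+ b)  ≡⟨ cong (a ℚ.+_) (ℚ.+-inverseˡ b) ⟩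
    a ℚ.+ 0ℚ           ≡⟨ ℚ.+-identityʳ a ⟩
    a                  ∎)
    where open ≡-Reasoning

  *-sub : ∀ a b c → (a ℚ.- b) ℚ.* c ≡ a ℚ.* c ℚ.- b ℚ.* c
  *-sub a b c = trans (ℚ.*-distribʳ-+ c a (ℚ.- b))
    (cong (a ℚ.* c ℚ.+_) (sym (ℚ.neg-distribˡ-* b c)))

  *-rearrange : ∀ a b c d → a ℚ.* b ℚ.- c ℚ.* d ≡ (a ℚ.- c) ℚ.* b ℚ.+ (b ℚ.- d) ℚ.* c
  *-rearrange a b c d = begin
    a ℚ.* b ℚ.- c ℚ.* d  ≡⟨ telescope (a ℚ.* b) (c ℚ.* b) (c ℚ.* d) ⟩
    (a ℚ.* b ℚ.- c ℚ.* b) ℚ.+ (c ℚ.* b ℚ.- c ℚ.* d)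
      ≡⟨ cong₂ (λ u v → (a ℚ.* b ℚ.- c ℚ.* b) ℚ.+ (u ℚ.- v)) (ℚ.*-comm c b) (ℚ.*-comm c d) ⟩
    (a ℚ.* b ℚ.- c ℚ.* b) ℚ.+ (b ℚ.* c ℚ.- d ℚ.* c)
      ≡⟨ cong₂ ℚ._+_ (*-sub a c b) (*-sub b d c) ⟨
    (a ℚ.- c) ℚ.* b ℚ.+ (b ℚ.- d) ℚ.* c ∎
    where open ≡-Reasoning

  halves : ∀ ε → ε ℚ.* ½ ℚ.+ ε ℚ.* ½ ≡ ε
  halves ε = trans (sym (ℚ.*-distribˡ-+ ε ½ ½)) (ℚ.*-identityʳ ε)

  half>0 : ∀ ε → 0ℚ ℚ.< ε → 0ℚ ℚ.< ε ℚ.* ½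
  half>0 ε 0<ε = subst (ℚ._< ε ℚ.* ½) (ℚ.*-zeroˡ ½) (ℚ.*-monoˡ-<-pos ½ 0<ε)

  +-cauchy : ∀ {s t} → IsCauchy s → IsCauchy t → IsCauchy (λ n → s n ℚ.+ t n)
  +-cauchy {s} {t} cs ct ε 0<ε
    with cs (ε ℚ.* ½) (half>0 ε 0<ε) | ct (ε ℚ.* ½) (half>0 ε 0<ε)
  ... | N₁ , close₁ | N₂ , close₂ = N₁ ℕ.⊔ N₂ , λ m n N≤m N≤n →
    let open ℚ.≤-Reasoning in begin-strict
      ∣ (s m ℚ.+ t m) ℚ.- (s n ℚ.+ t n) ∣
        ≡⟨ cong ∣_∣ (+-rearrange (s m) (t m) (s n) (t n)) ⟩
      ∣ (s m ℚ.- s n) ℚ.+ (t m ℚ.- t n) ∣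
        ≤⟨ ℚ.∣p+q∣≤∣p∣+∣q∣ (s m ℚ.- s n) (t m ℚ.- t n) ⟩
      ∣ s m ℚ.- s n ∣ ℚ.+ ∣ t m ℚ.- t n ∣
        <⟨ ℚ.+-mono-<
             (close₁ m n (ℕ.≤-trans (ℕ.m≤m⊔n N₁ N₂) N≤m) (ℕ.≤-trans (ℕ.m≤m⊔n N₁ N₂) N≤n))
             (close₂ m n (ℕ.≤-trans (ℕ.m≤n⊔m N₁ N₂) N≤m) (ℕ.≤-trans (ℕ.m≤n⊔m N₁ N₂) N≤n)) ⟩
      ε ℚ.* ½ ℚ.+ ε ℚ.* ½
        ≡⟨ halves ε ⟩
      ε ∎

  eventuallyBounded : ∀ {s} → IsCauchy s →
    ∃ λ B → 0ℚ ℚ.< B × ∃ λ N → ∀ n → N ℕ.≤ n → ∣ s n ∣ ℚ.≤ B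
  eventuallyBounded {s} cs with cs 1ℚ (ℚ.positive⁻¹ 1ℚ)
  ... | N , close = ∣ s N ∣ ℚ.+ 1ℚ , ℚ.+-mono-≤-< (ℚ.0≤∣p∣ (s N)) (ℚ.positive⁻¹ 1ℚ) , N ,
    λ n N≤n → let open ℚ.≤-Reasoning in begin
      ∣ s n ∣                            ≡⟨ cong ∣_∣ (split (s n) (s N)) ⟩
      ∣ s N ℚ.+ (s n ℚ.- s N) ∣          ≤⟨ ℚ.∣p+q∣≤∣p∣+∣q∣ (s N) (s n ℚ.- s N) ⟩
      ∣ s N ∣ ℚ.+ ∣ s n ℚ.- s N ∣        ≤⟨ ℚ.+-monoʳ-≤ ∣ s N ∣ (ℚ.<⇒≤ (close n N N≤n ℕ.≤-refl)) ⟩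
      ∣ s N ∣ ℚ.+ 1ℚ                     ∎

  scaleDown : ∀ {ε B} → 0ℚ ℚ.< ε → 0ℚ ℚ.< B →
    ∃ λ δ → 0ℚ ℚ.< δ × δ ℚ.* B ≡ ε ℚ.* ½
  scaleDown {ε} {B} 0<ε 0<B = δ , 0<δ , δ*B
    where
    B-pos : ℚ.Positive B
    B-pos = ℚ.positive 0<B

    B≢0 : ℚ.NonZero B
    B≢0 = ℚ.pos⇒nonZero B {{B-pos}}

    B⁻¹ : ℚ
    B⁻¹ = ℚ.1/_ B {{B≢0}}

    δ : ℚ
    δ = (ε ℚ.* ½) ℚ.* B⁻¹

    0<δ : 0ℚ ℚ.< δ
    0<δ = subst (ℚ._< δ) (ℚ.*-zeroˡ B⁻¹)
      (ℚ.*-monoˡ-<-pos B⁻¹ {{ℚ.1/pos⇒pos B {{B-pos}}}} (half>0 ε 0<ε))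

    δ*B : δ ℚ.* B ≡ ε ℚ.* ½
    δ*B = trans (ℚ.*-assoc (ε ℚ.* ½) B⁻¹ B)
      (trans (cong ((ε ℚ.* ½) ℚ.*_) (ℚ.*-inverseˡ B {{B≢0}})) (ℚ.*-identityʳ (ε ℚ.* ½)))

  product< : ∀ p q {B η} → 0ℚ ℚ.< B →
    ∣ p ∣ ℚ.< η → ∣ q ∣ ℚ.≤ B → ∣ p ℚ.* q ∣ ℚ.< η ℚ.* B
  product< p q {B} {η} 0<B p<η q≤B = let open ℚ.≤-Reasoning in begin-strict
    ∣ p ℚ.* q ∣      ≡⟨ ℚ.∣p*q∣≡∣p∣*∣q∣ p q ⟩
    ∣ p ∣ ℚ.* ∣ q ∣  ≤⟨ ℚ.*-monoˡ-≤-nonNeg ∣ p ∣ {{ℚ.∣-∣-nonNeg p}} q≤B ⟩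
    ∣ p ∣ ℚ.* B      <⟨ ℚ.*-monoˡ-<-pos B {{ℚ.positive 0<B}} p<η ⟩
    η ℚ.* B          ∎

  *-cauchy : ∀ {s t} → IsCauchy s → IsCauchy t → IsCauchy (λ n → s n ℚ.* t n)
  *-cauchy {s} {t} cs ct ε 0<ε with eventuallyBounded cs | eventuallyBounded ct
  ... | B₁ , 0<B₁ , M₁ , bound₁ | B₂ , 0<B₂ , M₂ , bound₂
    with scaleDown 0<ε 0<B₁ | scaleDown 0<ε 0<B₂
  ... | δ₁ , 0<δ₁ , δ₁B₁ | δ₂ , 0<δ₂ , δ₂B₂ with cs δ₂ 0<δ₂ | ct δ₁ 0<δ₁
  ... | K₁ , close₁ | K₂ , close₂ = N , close
    where
    N : ℕ
    N = (M₁ ℕ.⊔ M₂) ℕ.⊔ (K₁ ℕ.⊔ K₂)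

    module _ {n} (N≤n : N ℕ.≤ n) where
      M≤n = ℕ.≤-trans (ℕ.m≤m⊔n (M₁ ℕ.⊔ M₂) (K₁ ℕ.⊔ K₂)) N≤n
      K≤n = ℕ.≤-trans (ℕ.m≤n⊔m (M₁ ℕ.⊔ M₂) (K₁ ℕ.⊔ K₂)) N≤n
      M₁≤n = ℕ.≤-trans (ℕ.m≤m⊔n M₁ M₂) M≤n
      M₂≤n = ℕ.≤-trans (ℕ.m≤n⊔m M₁ M₂) M≤n
      K₁≤n = ℕ.≤-trans (ℕ.m≤m⊔n K₁ K₂) K≤n
      K₂≤n = ℕ.≤-trans (ℕ.m≤n⊔m K₁ K₂) K≤n

    close : ∀ m n → N ℕ.≤ m → N ℕ.≤ n →
      ∣ s m ℚ.* t m ℚ.- s n ℚ.* t n ∣ ℚ.< ε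
    close m n N≤m N≤n = let open ℚ.≤-Reasoning in begin-strict
      ∣ s m ℚ.* t m ℚ.- s n ℚ.* t n ∣
        ≡⟨ cong ∣_∣ (*-rearrange (s m) (t m) (s n) (t n)) ⟩
      ∣ (s m ℚ.- s n) ℚ.* t m ℚ.+ (t m ℚ.- t n) ℚ.* s n ∣
        ≤⟨ ℚ.∣p+q∣≤∣p∣+∣q∣ ((s m ℚ.- s n) ℚ.* t m) ((t m ℚ.- t n) ℚ.* s n) ⟩
      ∣ (s m ℚ.- s n) ℚ.* t m ∣ ℚ.+ ∣ (t m ℚ.- t n) ℚ.* s n ∣
        <⟨ ℚ.+-mono-<
             (product< (s m ℚ.- s n) (t m) 0<B₂
               (close₁ m n (K₁≤n N≤m) (K₁≤n N≤n)) (bound₂ m (M₂≤n N≤m)))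
             (product< (t m ℚ.- t n) (s n) 0<B₁
               (close₂ m n (K₂≤n N≤m) (K₂≤n N≤n)) (bound₁ n (M₁≤n N≤n))) ⟩
      δ₂ ℚ.* B₂ ℚ.+ δ₁ ℚ.* B₁
        ≡⟨ cong₂ ℚ._+_ δ₂B₂ δ₁B₁ ⟩
      ε ℚ.* ½ ℚ.+ ε ℚ.* ½
        ≡⟨ halves ε ⟩
      ε ∎

ℝ-rawSemiring : RawSemiring 0ℓ 0ℓ
ℝ-rawSemiring = record
  { Carrier = ℝ
  ; _≈_     = _≈_
  ; _+_     = λ x y → mkℝ (λ n → seq x n ℚ.+ seq y n)
                      (+-cauchy {seq x} {seq y} (cauchy x) (cauchy y))
  ; _*_     = λ x y → mkℝ (λ n → seq x n ℚ.* seq y n)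
                      (*-cauchy {seq x} {seq y} (cauchy x) (cauchy y))
  ; 0#      = fromℚ 0ℚ
  ; 1#      = fromℚ 1ℚ
  }

-- A d × n matrix is the vector of its d rows.

module Linear {c ℓ} (R : RawSemiring c ℓ) where
  open RawSemiring R hiding (_≈_)

  infixl 6 _+ᵥ_
  infixr 7 _·ᵥ_ _*ᵥ_

  _+ᵥ_ : ∀ {n} → Vec Carrier n → Vec Carrier n → Vec Carrier n
  _+ᵥ_ = zipWith _+_

  _·ᵥ_ : ∀ {n} → Carrier → Vec Carrier n → Vec Carrier n
  t ·ᵥ v = map (t *_) v

  dot : ∀ {n} → Vec Carrier n → Vec Carrier n → Carrier
  dot u v = foldr′ _+_ 0# (zipWith _*_ u v)

  _*ᵥ_ : ∀ {d n} → Vec (Vec Carrier n) d → Vec Carrier n → Vec Carrier d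
  M *ᵥ v = map (λ row → dot row v) M

module Linearℝ = Linear ℝ-rawSemiring
open Linear ℤ.+-*-rawSemiring public

Matrix : ℕ → ℕ → Set
Matrix d n = Vec (Vec ℤ n) d

infixr 7 _*ℕ_
_*ℕ_ : ∀ {d n} → Matrix d n → Vec ℕ n → Vec ℤ d
A *ℕ k = A *ᵥ map +_ k

infixl 6 _-ᵥ_
_-ᵥ_ : ∀ {d} → Vec ℤ d → Vec ℤ d → Vec ℤ d
_-ᵥ_ = zipWith ℤ._-_

toℝᵈ : ∀ {d} → Vec ℤ d → Vec ℝ d
toℝᵈ = map fromℤ

infixl 6 _+ˢ_ _-ˢ_

_+ˢ_ : ∀ {d} → Vec ℤ d → Pred (Vec ℤ d) 0ℓ → Pred (Vec ℤ d) 0ℓ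
(f +ˢ X) y = ∃ λ x → x ∈ X × y ≡ f +ᵥ x

_-ˢ_ : ∀ {d} → Pred (Vec ℤ d) 0ℓ → Vec ℤ d → Pred (Vec ℤ d) 0ℓ
(X -ˢ f) y = ∃ λ x → x ∈ X × y ≡ x -ᵥ f

ContainsLine : ∀ {d} → Pred (Vec ℝ d) 0ℓ → Set
ContainsLine {d} C = ∃ λ p → ∃ λ v →
  ¬ Pointwise _≈_ v (replicate d (fromℚ 0ℚ)) ×
  (∀ t → (p Linearℝ.+ᵥ t Linearℝ.·ᵥ v) ∈ C)

Pointed : ∀ {d} → Pred (Vec ℝ d) 0ℓ → Set
Pointed C = ¬ ContainsLine C

-- Polynomials in n variables over ℚ: lists of terms (coefficient ,
-- exponent vector), where exponents may repeat and coefficients may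
-- vanish; the ring ℚ[x₁,…,xₙ] is Poly n up to _≋_.

Poly : ℕ → Set
Poly n = List (ℚ × Vec ℕ n)

coeff : ∀ {n} → Poly n → Vec ℕ n → ℚ
coeff []            m = 0ℚ
coeff ((c , k) ∷ p) m = (if ⌊ ≡-dec ℕ._≟_ k m ⌋ then c else 0ℚ) ℚ.+ coeff p m

infix 4 _≋_
_≋_ : ∀ {n} → Poly n → Poly n → Set
p ≋ q = ∀ m → coeff p m ≡ coeff q m

infixl 6 _+ₚ_
infixl 7 _*ₚ_

_+ₚ_ : ∀ {n} → Poly n → Poly n → Poly n
_+ₚ_ = _++_

_*ₚ_ : ∀ {n} → Poly n → Poly n → Poly n
_*ₚ_ = cartesianProductWith λ (a , k) (b , l) → a ℚ.* b , zipWith ℕ._+_ k l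

x^_ : ∀ {n} → Vec ℕ n → Poly n
x^ k = (1ℚ , k) ∷ []

data ⟨_⟩ {n} (G : Pred (Poly n) 0ℓ) : Pred (Poly n) 0ℓ where
  generator : ∀ {p} → p ∈ G → p ∈ ⟨ G ⟩
  zero∈     : [] ∈ ⟨ G ⟩
  +-closed  : ∀ {p q} → p ∈ ⟨ G ⟩ → q ∈ ⟨ G ⟩ → p +ₚ q ∈ ⟨ G ⟩
  *-closed  : ∀ r {p} → p ∈ ⟨ G ⟩ → r *ₚ p ∈ ⟨ G ⟩
  ≋-closed  : ∀ {p q} → p ≋ q → p ∈ ⟨ G ⟩ → q ∈ ⟨ G ⟩

module _ {d n : ℕ} (A : Matrix d n) where

  Q : Pred (Vec ℤ d) 0ℓ
  Q x = ∃ λ k → x ≡ A *ℕ k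

  cone : Pred (Vec ℝ d) 0ℓ
  cone x = ∃ λ (k : Vec ℝ n) →
    All (fromℚ 0ℚ ≤_) k × Pointwise _≈_ x (map toℝᵈ A Linearℝ.*ᵥ k)

  lattice : Pred (Vec ℤ d) 0ℓ
  lattice x = ∃ λ k → x ≡ A *ᵥ k

  Qsat : Pred (Vec ℤ d) 0ℓ
  Qsat = (toℝᵈ ⊢ cone) ∩ lattice

  Hole : Pred (Vec ℤ d) 0ℓ
  Hole h = h ∈ Qsat × h ∉ Q

  FundamentalHole : Pred (Vec ℤ d) 0ℓ
  FundamentalHole h = h ∈ Hole ×
    ¬ (∃ λ h′ → h′ ∈ Hole × h′ ≢ h × (h -ᵥ h′) ∈ Q)

  SaturationPoint : Pred (Vec ℤ d) 0ℓ
  SaturationPoint s = s ∈ Q × (s +ˢ Qsat) ⊆ Q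

  MonomialIdeal : Vec ℤ d → Pred (Poly n) 0ℓ
  MonomialIdeal f =
    ⟨ (λ p → ∃ λ k → p ≡ x^ k × (f +ᵥ A *ℕ k) ∈ (f +ˢ Q) ∩ Q) ⟩

  ⋂F : ∀ {B : Set} → (Vec ℤ d → Pred B 0ℓ) → Pred B 0ℓ
  ⋂F P = ⋂ (∃ FundamentalHole) (λ (f , _) → P f)

{-# OPTIONS --safe #-}

-- Since cone(A) is pointed, Gordan's alternative gives an integral functional c that is positive on
-- every nonzero column of A.  It makes membership in Q decidable (only finitely many candidate
-- coefficients) and is a nonnegative grading of Q_sat, so replacing a hole h by a smaller hole h′ with
-- h − h′ ∈ Q strictly decreases c · h and must stop at a fundamental hole.  Hence if s + f ∈ Q for every
-- fundamental f, then s + h ∈ Q for every hole h.  For the second description, the exponents k with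
-- f + A k ∈ Q are closed under adding ℕⁿ, so they are exactly the exponents of monomials in I_{A,f}.
module Submission where

open import Defs
open import Algebra.Bundles using (CommutativeSemiring; CommutativeMonoid; CommutativeRing)
open import Algebra.Bundles.Raw using (RawSemiring)
import Algebra.Properties.CommutativeSemigroup as CommutativeSemigroupProperties
open import Data.Bool.Base using (if_then_else_)
open import Data.Empty using (⊥-elim)
open import Data.Integer.Base as ℤ using (ℤ; +_; 0ℤ; 1ℤ; -1ℤ)
import Data.Integer.Properties as ℤ
import Data.Integer.Tactic.RingSolver as ℤSolver
open import Data.List.Base as List using ([]; _∷_)
open import Data.Nat.Base as ℕ using (ℕ; zero; suc)
import Data.Nat.Properties as ℕ
open import Data.Product using (∃; _×_; _,_; proj₁; proj₂)
open import Data.Rational.Base as ℚ using (ℚ; 0ℚ; ½; ∣_∣)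
import Data.Rational.Properties as ℚ
import Data.Rational.Solver as ℚSolver
open import Data.Rational.Unnormalised.Base as ℚᵘ using (mkℚᵘ)
import Data.Rational.Unnormalised.Properties as ℚᵘ
open import Data.Sum.Base using (_⊎_; inj₁; inj₂)
open import Data.Vec.Base using (Vec; []; _∷_; map; zipWith; replicate; head; tail)
open import Data.Vec.Properties
  using (≡-dec; ∷-injectiveˡ; ∷-injectiveʳ; zipWith-assoc; zipWith-comm; zipWith-identityˡ)
open import Data.Vec.Relation.Binary.Pointwise.Inductive using (Pointwise; []; _∷_)
open import Data.Vec.Relation.Unary.All as All using (All; []; _∷_)
open import Data.Vec.Relation.Unary.All.Properties using (map⁺; map⁻)
open import Function.Base using (_∘_)
open import Level using (0ℓ)
open import Relation.Binary.Definitions using (tri<; tri≈; tri>)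
open import Relation.Binary.PropositionalEquality
  using (_≡_; _≢_; refl; sym; trans; cong; cong₂; subst; module ≡-Reasoning)
open import Relation.Nullary using (¬_; Dec; yes; no)
open import Relation.Nullary.Decidable using (⌊_⌋; map′; decidable-stable)
open import Relation.Unary using (Pred; _∈_; _∉_; _⊆_; _∩_; _≐_)

-- Linear algebra over a commutative semiring and over ℤ

-- The same identities serve over ℤ for gradings and over ℚ for the terms of Cauchy sequences.
module DotProperties {c ℓ} (R : CommutativeSemiring c ℓ) where
  open CommutativeSemiring R
    renaming (Carrier to K; _≈_ to _≈ᴷ_; refl to ≈-refl; sym to ≈-sym; trans to ≈-trans)
  open Linear rawSemiring
    renaming (dot to dotᴷ; _+ᵥ_ to _+ᴷ_; _·ᵥ_ to _·ᴷ_; _*ᵥ_ to _*ᴷ_)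
  open CommutativeSemigroupProperties (CommutativeMonoid.commutativeSemigroup +-commutativeMonoid)
    using (interchange)
  open CommutativeSemigroupProperties *-commutativeSemigroup
    using (x∙yz≈y∙xz; x∙yz≈z∙xy)
  open import Relation.Binary.Reasoning.Setoid setoid

  dot-comm : ∀ {n} (u v : Vec K n) → dotᴷ u v ≈ᴷ dotᴷ v u
  dot-comm [] [] = ≈-refl
  dot-comm (a ∷ u) (b ∷ v) = +-cong (*-comm a b) (dot-comm u v)

  dot-+ᵥ : ∀ {n} (u v w : Vec K n) → dotᴷ u (v +ᴷ w) ≈ᴷ dotᴷ u v + dotᴷ u w
  dot-+ᵥ [] [] [] = ≈-sym (+-identityˡ 0#)
  dot-+ᵥ (a ∷ u) (b ∷ v) (c ∷ w) = begin
    a * (b + c) + dotᴷ u (v +ᴷ w)             ≈⟨ +-cong (distribˡ a b c) (dot-+ᵥ u v w) ⟩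
    (a * b + a * c) + (dotᴷ u v + dotᴷ u w)    ≈⟨ interchange _ _ _ _ ⟩
    (a * b + dotᴷ u v) + (a * c + dotᴷ u w)    ∎

  dot-·ᵥ : ∀ {n} (u : Vec K n) t (v : Vec K n) → dotᴷ u (t ·ᴷ v) ≈ᴷ t * dotᴷ u v
  dot-·ᵥ [] t [] = ≈-sym (zeroʳ t)
  dot-·ᵥ (a ∷ u) t (b ∷ v) = begin
    a * (t * b) + dotᴷ u (t ·ᴷ v)  ≈⟨ +-cong (x∙yz≈y∙xz a t b) (dot-·ᵥ u t v) ⟩
    t * (a * b) + t * dotᴷ u v     ≈⟨ distribˡ t (a * b) (dotᴷ u v) ⟨
    t * (a * b + dotᴷ u v)         ∎

  dot-0ᵥ : ∀ {n} (u : Vec K n) → dotᴷ u (replicate n 0#) ≈ᴷ 0#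
  dot-0ᵥ [] = ≈-refl
  dot-0ᵥ (a ∷ u) = ≈-trans (+-cong (zeroʳ a) (dot-0ᵥ u)) (+-identityˡ 0#)

  dot-*ᵥ-[] : ∀ {d} (u : Vec K d) (M : Vec (Vec K 0) d) → dotᴷ u (M *ᴷ []) ≈ᴷ 0#
  dot-*ᵥ-[] [] [] = ≈-refl
  dot-*ᵥ-[] (a ∷ u) ([] ∷ M) = ≈-trans (+-cong (zeroʳ a) (dot-*ᵥ-[] u M)) (+-identityˡ 0#)

  -- Matrices are stored by rows, while the inductions on `Q` and on the cone run over columns; this
  -- identity splits off the first column.
  dot-*ᵥ-∷ : ∀ {d n} (u : Vec K d) (M : Vec (Vec K (suc n)) d) x xs →
    dotᴷ u (M *ᴷ (x ∷ xs)) ≈ᴷ x * dotᴷ u (map head M) + dotᴷ u (map tail M *ᴷ xs)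
  dot-*ᵥ-∷ [] [] x xs = ≈-sym (≈-trans (+-identityʳ _) (zeroʳ x))
  dot-*ᵥ-∷ (a ∷ u) ((b ∷ r) ∷ M) x xs = begin
    a * (b * x + dotᴷ r xs) + dotᴷ u (M *ᴷ (x ∷ xs))
      ≈⟨ +-cong (distribˡ a (b * x) (dotᴷ r xs)) (dot-*ᵥ-∷ u M x xs) ⟩
    (a * (b * x) + a * dotᴷ r xs) + (x * dotᴷ u (map head M) + dotᴷ u (map tail M *ᴷ xs))
      ≈⟨ interchange _ _ _ _ ⟩
    (a * (b * x) + x * dotᴷ u (map head M)) + (a * dotᴷ r xs + dotᴷ u (map tail M *ᴷ xs))
      ≈⟨ +-congʳ (+-congʳ (x∙yz≈z∙xy a b x)) ⟩
    (x * (a * b) + x * dotᴷ u (map head M)) + (a * dotᴷ r xs + dotᴷ u (map tail M *ᴷ xs))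
      ≈⟨ +-congʳ (distribˡ x (a * b) (dotᴷ u (map head M))) ⟨
    x * (a * b + dotᴷ u (map head M)) + (a * dotᴷ r xs + dotᴷ u (map tail M *ᴷ xs)) ∎

open DotProperties ℤ.+-*-commutativeSemiring

0ᵥ : ∀ {d} → Vec ℤ d
0ᵥ {d} = replicate d 0ℤ

infix 4 _≟ᵥ_
_≟ᵥ_ : ∀ {d} (u v : Vec ℤ d) → Dec (u ≡ v)
_≟ᵥ_ = ≡-dec ℤ._≟_

+ᵥ-identityˡ : ∀ {d} (v : Vec ℤ d) → 0ᵥ +ᵥ v ≡ v
+ᵥ-identityˡ = zipWith-identityˡ ℤ.+-identityˡ

+ᵥ-comm : ∀ {d} (u v : Vec ℤ d) → u +ᵥ v ≡ v +ᵥ u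
+ᵥ-comm = zipWith-comm ℤ.+-comm

0·ᵥ : ∀ {d} (v : Vec ℤ d) → 0ℤ ·ᵥ v ≡ 0ᵥ
0·ᵥ [] = refl
0·ᵥ (x ∷ v) = cong₂ _∷_ (ℤ.*-zeroˡ x) (0·ᵥ v)

·ᵥ-0ᵥ : ∀ {d} t → t ·ᵥ 0ᵥ {d} ≡ 0ᵥ
·ᵥ-0ᵥ {zero} t = refl
·ᵥ-0ᵥ {suc d} t = cong₂ _∷_ (ℤ.*-zeroʳ t) (·ᵥ-0ᵥ t)

·ᵥ≡0ᵥ : ∀ {d t} (v : Vec ℤ d) → t ≢ 0ℤ → t ·ᵥ v ≡ 0ᵥ → v ≡ 0ᵥ
·ᵥ≡0ᵥ [] t≢0 eq = refl
·ᵥ≡0ᵥ {t = t} (x ∷ v) t≢0 eq with ℤ.i*j≡0⇒i≡0∨j≡0 t (∷-injectiveˡ eq)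
... | inj₁ t≡0 = ⊥-elim (t≢0 t≡0)
... | inj₂ x≡0 = cong₂ _∷_ x≡0 (·ᵥ≡0ᵥ v t≢0 (∷-injectiveʳ eq))

+ᵥ--ᵥ-cancel : ∀ {d} (u v : Vec ℤ d) → (u +ᵥ v) -ᵥ u ≡ v
+ᵥ--ᵥ-cancel [] [] = refl
+ᵥ--ᵥ-cancel (x ∷ u) (y ∷ v) = cong₂ _∷_ (lemma x y) (+ᵥ--ᵥ-cancel u v)
  where
  lemma : ∀ x y → (x ℤ.+ y) ℤ.- x ≡ y
  lemma = ℤSolver.solve-∀

+ᵥ--ᵥ-split : ∀ {d} (u v : Vec ℤ d) → u +ᵥ (v -ᵥ u) ≡ v
+ᵥ--ᵥ-split [] [] = refl
+ᵥ--ᵥ-split (x ∷ u) (y ∷ v) = cong₂ _∷_ (lemma x y) (+ᵥ--ᵥ-split u v)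
  where
  lemma : ∀ x y → x ℤ.+ (y ℤ.- x) ≡ y
  lemma = ℤSolver.solve-∀

+ᵥ-assoc : ∀ {d} (u v w : Vec ℤ d) → (u +ᵥ v) +ᵥ w ≡ u +ᵥ (v +ᵥ w)
+ᵥ-assoc = zipWith-assoc ℤ.+-assoc

dot-linear : ∀ {d} (s t : ℤ) (u v a : Vec ℤ d) →
  dot (s ·ᵥ u +ᵥ t ·ᵥ v) a ≡ s ℤ.* dot u a ℤ.+ t ℤ.* dot v a
dot-linear s t u v a = begin
  dot (s ·ᵥ u +ᵥ t ·ᵥ v) a                ≡⟨ dot-comm (s ·ᵥ u +ᵥ t ·ᵥ v) a ⟩
  dot a (s ·ᵥ u +ᵥ t ·ᵥ v)                ≡⟨ dot-+ᵥ a (s ·ᵥ u) (t ·ᵥ v) ⟩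
  dot a (s ·ᵥ u) ℤ.+ dot a (t ·ᵥ v)       ≡⟨ cong₂ ℤ._+_ (dot-·ᵥ a s u) (dot-·ᵥ a t v) ⟩
  s ℤ.* dot a u ℤ.+ t ℤ.* dot a v         ≡⟨ cong₂ (λ x y → s ℤ.* x ℤ.+ t ℤ.* y) (dot-comm a u) (dot-comm a v) ⟩
  s ℤ.* dot u a ℤ.+ t ℤ.* dot v a         ∎
  where open ≡-Reasoning

0≤i*i : ∀ i → 0ℤ ℤ.≤ i ℤ.* i
0≤i*i (+ n) = subst (0ℤ ℤ.≤_) (ℤ.pos-* n n) (ℤ.+≤+ ℕ.z≤n)
0≤i*i ℤ.-[1+ n ] = ℤ.+≤+ ℕ.z≤n

0<*⁺ : ∀ {i j} → 0ℤ ℤ.< i → 0ℤ ℤ.< j → 0ℤ ℤ.< i ℤ.* j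
0<*⁺ {i} {j} 0<i 0<j =
  subst (ℤ._< i ℤ.* j) (ℤ.*-zeroʳ i) (ℤ.*-monoˡ-<-pos i {{ℤ.positive 0<i}} 0<j)

0<i*i : ∀ {i} → i ≢ 0ℤ → 0ℤ ℤ.< i ℤ.* i
0<i*i {i} i≢0 = ℤ.≤∧≢⇒< (0≤i*i i) λ 0≡i*i → case (ℤ.i*j≡0⇒i≡0∨j≡0 i (sym 0≡i*i))
  where
  case : ¬ (i ≡ 0ℤ ⊎ i ≡ 0ℤ)
  case (inj₁ eq) = i≢0 eq
  case (inj₂ eq) = i≢0 eq

0≤dot-self : ∀ {d} (v : Vec ℤ d) → 0ℤ ℤ.≤ dot v v
0≤dot-self [] = ℤ.≤-refl
0≤dot-self (x ∷ v) = ℤ.+-mono-≤ (0≤i*i x) (0≤dot-self v)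

0<dot-self : ∀ {d} {v : Vec ℤ d} → v ≢ 0ᵥ → 0ℤ ℤ.< dot v v
0<dot-self {v = []} v≢0 = ⊥-elim (v≢0 refl)
0<dot-self {v = x ∷ v} v≢0 with x ℤ.≟ 0ℤ
... | yes refl = ℤ.+-mono-≤-< (0≤i*i x) (0<dot-self (v≢0 ∘ cong (0ℤ ∷_)))
... | no x≢0 = ℤ.+-mono-<-≤ (0<i*i x≢0) (0≤dot-self v)

-- Gordan's alternative

-- The first alternative is there because `A` may have zero columns, on which no functional is
-- positive.
Positive : ∀ {d} → Vec ℤ d → Pred (Vec ℤ d) 0ℓ
Positive c a = a ≡ 0ᵥ ⊎ 0ℤ ℤ.< dot c a

positive⇒0≤dot : ∀ {d} {c : Vec ℤ d} {a} → a ∈ Positive c → 0ℤ ℤ.≤ dot c a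
positive⇒0≤dot {c = c} (inj₁ refl) = ℤ.≤-reflexive (sym (dot-0ᵥ c))
positive⇒0≤dot (inj₂ 0<ca) = ℤ.<⇒≤ 0<ca

positive⇒0<dot : ∀ {d} {c a : Vec ℤ d} → a ≢ 0ᵥ → a ∈ Positive c → 0ℤ ℤ.< dot c a
positive⇒0<dot a≢0 (inj₁ a≡0) = ⊥-elim (a≢0 a≡0)
positive⇒0<dot a≢0 (inj₂ 0<ca) = 0<ca

positive-+ᵥ : ∀ {d} {c u v : Vec ℤ d} → u ∈ Positive c → v ∈ Positive c → u +ᵥ v ∈ Positive c
positive-+ᵥ {c = c} {v = v} (inj₁ refl) pos = subst (Positive c) (sym (+ᵥ-identityˡ v)) pos
positive-+ᵥ {c = c} {u} {v} (inj₂ 0<cu) pos = inj₂ (subst (0ℤ ℤ.<_) (sym (dot-+ᵥ c u v))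
  (ℤ.+-mono-<-≤ 0<cu (positive⇒0≤dot {c = c} pos)))

positive-·ᵥ : ∀ {d} {c v : Vec ℤ d} m → v ∈ Positive c → + m ·ᵥ v ∈ Positive c
positive-·ᵥ {v = v} zero pos = inj₁ (0·ᵥ v)
positive-·ᵥ (suc m) (inj₁ refl) = inj₁ (·ᵥ-0ᵥ (+ suc m))
positive-·ᵥ {c = c} {v} (suc m) (inj₂ 0<cv) = inj₂ (subst (0ℤ ℤ.<_) (sym (dot-·ᵥ c (+ suc m) v))
  (0<*⁺ {+ suc m} (ℤ.+<+ (ℕ.s≤s ℕ.z≤n)) 0<cv))

-- A large multiple of `c` outweighs any fixed `e` on finitely many vectors. Asking for all `m`
-- above the threshold lets the thresholds be merged by a maximum.
positive-perturb : ∀ {d n} (c e : Vec ℤ d) {as : Vec (Vec ℤ d) n} → All (Positive c) as →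
  ∃ λ N → ∀ m → N ℕ.≤ m → All (Positive (+ m ·ᵥ c +ᵥ 1ℤ ·ᵥ e)) as
positive-perturb c e [] = 0 , λ _ _ → []
positive-perturb c e (inj₁ a≡0 ∷ pos) with positive-perturb c e pos
... | N , rest = N , λ m N≤m → inj₁ a≡0 ∷ rest m N≤m
positive-perturb c e {a ∷ _} (inj₂ 0<ca ∷ pos) with positive-perturb c e pos
-- By integrality `dot c a` is at least 1, so any `m` exceeding the absolute value of `dot e a`
-- suffices.
... | N , rest = suc ℤ.∣ dot e a ∣ ℕ.⊔ N , λ m N≤m →
  inj₂ (subst (0ℤ ℤ.<_) (sym (dot-linear (+ m) 1ℤ c e a))
    (large m (ℕ.≤-trans (ℕ.m≤m⊔n _ N) N≤m)))
  ∷ rest m (ℕ.≤-trans (ℕ.m≤n⊔m _ N) N≤m)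
  where
  0<m+i : ∀ m i → ℤ.∣ i ∣ ℕ.< m → 0ℤ ℤ.< + m ℤ.+ i
  0<m+i m (+ n) n<m = ℤ.+<+ (ℕ.≤-trans (ℕ.≤-trans (ℕ.s≤s ℕ.z≤n) n<m) (ℕ.m≤m+n m n))
  0<m+i m ℤ.-[1+ n ] n<m = subst (0ℤ ℤ.<_) (sym (ℤ.⊖-≥ (ℕ.<⇒≤ n<m))) (ℤ.+<+ (ℕ.m<n⇒0<n∸m n<m))

  large : ∀ m → ℤ.∣ dot e a ∣ ℕ.< m → 0ℤ ℤ.< + m ℤ.* dot c a ℤ.+ 1ℤ ℤ.* dot e a
  large m big = begin-strict
    0ℤ                                     <⟨ 0<m+i m (dot e a) big ⟩
    + m ℤ.+ dot e a                        ≡⟨ cong₂ ℤ._+_ (ℤ.*-identityʳ (+ m)) (ℤ.*-identityˡ (dot e a)) ⟨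
    + m ℤ.* 1ℤ ℤ.+ 1ℤ ℤ.* dot e a          ≤⟨ ℤ.+-monoˡ-≤ (1ℤ ℤ.* dot e a)
                                                (ℤ.*-monoˡ-≤-nonNeg (+ m) (ℤ.i<j⇒suc[i]≤j 0<ca)) ⟩
    + m ℤ.* dot c a ℤ.+ 1ℤ ℤ.* dot e a     ∎
    where open ℤ.≤-Reasoning

-- The induction replaces vectors by nonnegative combinations of them. These are no longer columns
-- of `A`, so an abstract pointed semigroup `P` carries the hypotheses along.
module Gordan {d} (P : Pred (Vec ℤ d) 0ℓ)
  (+-closed  : ∀ {u v} → u ∈ P → v ∈ P → u +ᵥ v ∈ P)
  (·-closed  : ∀ m {v} → v ∈ P → + m ·ᵥ v ∈ P)
  (pointed   : ∀ {u v} → u ∈ P → v ∈ P → u +ᵥ v ≡ 0ᵥ → u ≡ 0ᵥ)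
  where

  -- As `c` vanishes on `b`, the functional `N c + e` agrees with `e` there, while a large `N`
  -- preserves positivity on `as`.
  tilt : ∀ {n} (c e b : Vec ℤ d) {as : Vec (Vec ℤ d) n} → All (Positive c) as →
    dot c b ≡ 0ℤ → 0ℤ ℤ.< dot e b → ∃ λ c′ → All (Positive c′) (b ∷ as)
  tilt c e b pos cb≡0 0<eb with positive-perturb c e pos
  ... | N , rest = + N ·ᵥ c +ᵥ 1ℤ ·ᵥ e ,
    inj₂ (subst (0ℤ ℤ.<_) (sym eb) 0<eb) ∷ rest N ℕ.≤-refl
    where
    open ≡-Reasoning
    eb : dot (+ N ·ᵥ c +ᵥ 1ℤ ·ᵥ e) b ≡ dot e b
    eb = begin
      dot (+ N ·ᵥ c +ᵥ 1ℤ ·ᵥ e) b          ≡⟨ dot-linear (+ N) 1ℤ c e b ⟩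
      + N ℤ.* dot c b ℤ.+ 1ℤ ℤ.* dot e b   ≡⟨ cong₂ ℤ._+_ (trans (cong (+ N ℤ.*_) cb≡0) (ℤ.*-zeroʳ (+ N)))
                                                          (ℤ.*-identityˡ (dot e b)) ⟩
      0ℤ ℤ.+ dot e b                       ≡⟨ ℤ.+-identityˡ (dot e b) ⟩
      dot e b                              ∎

  -- If c · b < 0, the nonnegative combination project c b a of a and b lies on c⊥.
  project : (c b a : Vec ℤ d) → Vec ℤ d
  project c b a = + ℤ.∣ dot c b ∣ ·ᵥ a +ᵥ + ℤ.∣ dot c a ∣ ·ᵥ b

  project∈P : ∀ c {b a} → b ∈ P → a ∈ P → project c b a ∈ P
  project∈P c {b} {a} b∈P a∈P = +-closed (·-closed ℤ.∣ dot c b ∣ a∈P) (·-closed ℤ.∣ dot c a ∣ b∈P)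

  -- The coefficients are chosen so that the new functional takes on `a` the value of `c′` on
  -- `project c b a`; this is the Fourier-Motzkin elimination of `b`.
  positive-lift : ∀ (c c′ : Vec ℤ d) {b a} → b ∈ P → b ≢ 0ᵥ → a ∈ P → dot c b ℤ.< 0ℤ →
    a ∈ Positive c → project c b a ∈ Positive c′ →
    a ∈ Positive (dot c′ b ·ᵥ c +ᵥ (ℤ.- dot c b) ·ᵥ c′)
  positive-lift c c′ b∈P b≢0 a∈P cb<0 (inj₁ a≡0) _ = inj₁ a≡0
  -- A zero projection makes a positive multiple of `b` the negative of an element of `P`;
  -- pointedness then forces `b` to be zero.
  positive-lift c c′ {b} {a} b∈P b≢0 a∈P cb<0 (inj₂ 0<ca) (inj₁ a′≡0) =
    ⊥-elim (b≢0 (·ᵥ≡0ᵥ b (λ eq → ℤ.<-irrefl (sym (trans (sym ca) eq)) 0<ca)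
      (pointed (·-closed ℤ.∣ dot c a ∣ b∈P) (·-closed ℤ.∣ dot c b ∣ a∈P)
        (trans (+ᵥ-comm _ _) a′≡0))))
    where
    ca : + ℤ.∣ dot c a ∣ ≡ dot c a
    ca = ℤ.0≤i⇒+∣i∣≡i (ℤ.<⇒≤ 0<ca)
  positive-lift c c′ {b} {a} b∈P b≢0 a∈P cb<0 (inj₂ 0<ca) (inj₂ 0<c′a′) =
    inj₂ (subst (0ℤ ℤ.<_) eq 0<c′a′)
    where
    open ≡-Reasoning
    cb : + ℤ.∣ dot c b ∣ ≡ ℤ.- dot c b
    cb = trans (cong +_ (sym (ℤ.∣-i∣≡∣i∣ (dot c b))))
      (ℤ.0≤i⇒+∣i∣≡i (ℤ.neg-mono-≤ (ℤ.<⇒≤ cb<0)))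

    swap : ∀ x y z w → x ℤ.* y ℤ.+ z ℤ.* w ≡ w ℤ.* z ℤ.+ x ℤ.* y
    swap = ℤSolver.solve-∀

    eq : dot c′ (project c b a) ≡ dot (dot c′ b ·ᵥ c +ᵥ (ℤ.- dot c b) ·ᵥ c′) a
    eq = begin
      dot c′ (project c b a)
        ≡⟨ dot-comm c′ (project c b a) ⟩
      dot (project c b a) c′
        ≡⟨ dot-linear (+ ℤ.∣ dot c b ∣) (+ ℤ.∣ dot c a ∣) a b c′ ⟩
      + ℤ.∣ dot c b ∣ ℤ.* dot a c′ ℤ.+ + ℤ.∣ dot c a ∣ ℤ.* dot b c′
        ≡⟨ cong₂ ℤ._+_ (cong₂ ℤ._*_ cb (dot-comm a c′))
                       (cong₂ ℤ._*_ (ℤ.0≤i⇒+∣i∣≡i (ℤ.<⇒≤ 0<ca)) (dot-comm b c′)) ⟩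
      (ℤ.- dot c b) ℤ.* dot c′ a ℤ.+ dot c a ℤ.* dot c′ b
        ≡⟨ swap (ℤ.- dot c b) (dot c′ a) (dot c a) (dot c′ b) ⟩
      dot c′ b ℤ.* dot c a ℤ.+ (ℤ.- dot c b) ℤ.* dot c′ a
        ≡⟨ dot-linear (dot c′ b) (ℤ.- dot c b) c c′ a ⟨
      dot (dot c′ b ·ᵥ c +ᵥ (ℤ.- dot c b) ·ᵥ c′) a ∎

  -- Induction on the number of vectors: a functional for `as` is tested on the new vector `b` and
  -- corrected according to the sign of `dot c b`.
  gordan : ∀ n {as : Vec (Vec ℤ d) n} → All P as → ∃ λ c → All (Positive c) as
  gordan zero [] = 0ᵥ , []
  gordan (suc n) {b ∷ as} (b∈P ∷ as∈P) with gordan n as∈P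
  ... | c , pos with b ≟ᵥ 0ᵥ
  ... | yes b≡0 = c , inj₁ b≡0 ∷ pos
  ... | no b≢0 with ℤ.<-cmp 0ℤ (dot c b)
  ... | tri< 0<cb _ _ = c , inj₂ 0<cb ∷ pos
  -- The correction is `b` itself, whose square norm is positive.
  ... | tri≈ _ 0≡cb _ = tilt c b b pos (sym 0≡cb) (0<dot-self b≢0)
  -- All of `as` is pushed along `b` onto the hyperplane orthogonal to `c`, which leaves one vector
  -- fewer.
  ... | tri> _ _ cb<0 with gordan n (map⁺ (All.map (project∈P c b∈P) as∈P))
  -- The lifted functional vanishes on `b`, where the negative of `c` is positive, so tilting by
  -- that negative finishes.
  ...   | c′ , pos′ = tilt (dot c′ b ·ᵥ c +ᵥ (ℤ.- dot c b) ·ᵥ c′) (-1ℤ ·ᵥ c) b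
    (lift as∈P pos (map⁻ pos′)) (trans (dot-linear (dot c′ b) (ℤ.- dot c b) c c′ b) (vanish (dot c′ b) (dot c b)))
    (subst (0ℤ ℤ.<_) (sym -cb) (ℤ.neg-mono-< cb<0))
    where
    lift : ∀ {m} {as : Vec (Vec ℤ d) m} → All P as → All (Positive c) as →
      All (λ a → project c b a ∈ Positive c′) as →
      All (Positive (dot c′ b ·ᵥ c +ᵥ (ℤ.- dot c b) ·ᵥ c′)) as
    lift [] [] [] = []
    lift (a∈P ∷ as∈P) (p ∷ ps) (p′ ∷ ps′) =
      positive-lift c c′ b∈P b≢0 a∈P cb<0 p p′ ∷ lift as∈P ps ps′

    vanish : ∀ x y → x ℤ.* y ℤ.+ (ℤ.- y) ℤ.* x ≡ 0ℤ
    vanish = ℤSolver.solve-∀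

    -cb : dot (-1ℤ ·ᵥ c) b ≡ ℤ.- dot c b
    -cb = trans (dot-comm (-1ℤ ·ᵥ c) b) (trans (dot-·ᵥ b -1ℤ c)
      (trans (ℤ.-1*i≡-i (dot b c)) (cong ℤ.-_ (dot-comm b c))))

-- The semigroup Q and gradings of it

*ᵥ-+ᵥ : ∀ {d n} (A : Matrix d n) (u v : Vec ℤ n) → A *ᵥ (u +ᵥ v) ≡ A *ᵥ u +ᵥ A *ᵥ v
*ᵥ-+ᵥ [] u v = refl
*ᵥ-+ᵥ (r ∷ A) u v = cong₂ _∷_ (dot-+ᵥ r u v) (*ᵥ-+ᵥ A u v)

*ᵥ-·ᵥ : ∀ {d n} (A : Matrix d n) t (v : Vec ℤ n) → A *ᵥ (t ·ᵥ v) ≡ t ·ᵥ (A *ᵥ v)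
*ᵥ-·ᵥ [] t v = refl
*ᵥ-·ᵥ (r ∷ A) t v = cong₂ _∷_ (dot-·ᵥ r t v) (*ᵥ-·ᵥ A t v)

*ᵥ-0ᵥ : ∀ {d n} (A : Matrix d n) → A *ᵥ 0ᵥ ≡ 0ᵥ
*ᵥ-0ᵥ [] = refl
*ᵥ-0ᵥ (r ∷ A) = cong₂ _∷_ (dot-0ᵥ r) (*ᵥ-0ᵥ A)

*ᵥ-[] : ∀ {d} (A : Matrix d 0) → A *ᵥ [] ≡ 0ᵥ
*ᵥ-[] [] = refl
*ᵥ-[] ([] ∷ A) = cong (0ℤ ∷_) (*ᵥ-[] A)

*ᵥ-∷ : ∀ {d n} (A : Matrix d (suc n)) x xs →
  A *ᵥ (x ∷ xs) ≡ x ·ᵥ map head A +ᵥ map tail A *ᵥ xs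
*ᵥ-∷ [] x xs = refl
*ᵥ-∷ ((b ∷ r) ∷ A) x xs = cong₂ _∷_ (cong (ℤ._+ dot r xs) (ℤ.*-comm b x)) (*ᵥ-∷ A x xs)

map-+_-zipWith : ∀ {n} (k l : Vec ℕ n) → map +_ (zipWith ℕ._+_ k l) ≡ map +_ k +ᵥ map +_ l
map-+_-zipWith [] [] = refl
map-+_-zipWith (x ∷ k) (y ∷ l) = cong (_ ∷_) (map-+_-zipWith k l)

map-+_-scale : ∀ {n} m (k : Vec ℕ n) → map +_ (map (m ℕ.*_) k) ≡ + m ·ᵥ map +_ k
map-+_-scale m [] = refl
map-+_-scale m (x ∷ k) = cong₂ _∷_ (ℤ.pos-* m x) (map-+_-scale m k)

map-+_-replicate : ∀ n → map +_ (replicate n 0) ≡ 0ᵥ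
map-+_-replicate zero = refl
map-+_-replicate (suc n) = cong (0ℤ ∷_) (map-+_-replicate n)

*ℕ-+ : ∀ {d n} (A : Matrix d n) (k l : Vec ℕ n) → A *ℕ zipWith ℕ._+_ k l ≡ A *ℕ k +ᵥ A *ℕ l
*ℕ-+ A k l = trans (cong (A *ᵥ_) (map-+_-zipWith k l)) (*ᵥ-+ᵥ A (map +_ k) (map +_ l))

Q-+ᵥ : ∀ {d n} (A : Matrix d n) {x y} → x ∈ Q A → y ∈ Q A → x +ᵥ y ∈ Q A
Q-+ᵥ A (k , refl) (l , refl) = zipWith ℕ._+_ k l , sym (*ℕ-+ A k l)

Q-·ᵥ : ∀ {d n} (A : Matrix d n) m {x} → x ∈ Q A → + m ·ᵥ x ∈ Q A
Q-·ᵥ A m (k , refl) = map (m ℕ.*_) k ,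
  sym (trans (cong (A *ᵥ_) (map-+_-scale m k)) (*ᵥ-·ᵥ A (+ m) (map +_ k)))

Q-0ᵥ : ∀ {d n} (A : Matrix d n) → 0ᵥ ∈ Q A
Q-0ᵥ {n = n} A = replicate n 0 ,
  sym (trans (cong (A *ᵥ_) (map-+_-replicate n)) (*ᵥ-0ᵥ A))

columns : ∀ {d n} → Matrix d n → Vec (Vec ℤ d) n
columns {n = zero} A = []
columns {n = suc n} A = map head A ∷ columns (map tail A)

Q-cons : ∀ {d n} (A : Matrix d (suc n)) m {x} → x ∈ Q (map tail A) → + m ·ᵥ map head A +ᵥ x ∈ Q A
Q-cons A m (k , refl) = m ∷ k , sym (*ᵥ-∷ A (+ m) (map +_ k))

Q-tail : ∀ {d n} (A : Matrix d (suc n)) → Q (map tail A) ⊆ Q A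
Q-tail A {x} x∈Q = subst (_∈ Q A)
  (trans (cong (_+ᵥ x) (0·ᵥ (map head A))) (+ᵥ-identityˡ x)) (Q-cons A 0 x∈Q)

columns∈Q : ∀ {d n} (A : Matrix d n) → All (Q A) (columns A)
columns∈Q {n = zero} A = []
columns∈Q {n = suc n} A = subst (_∈ Q A) (1·ᵥ+0ᵥ (map head A)) (Q-cons A 1 (Q-0ᵥ (map tail A)))
  ∷ All.map (Q-tail A) (columns∈Q (map tail A))
  where
  1·ᵥ+0ᵥ : ∀ {d} (v : Vec ℤ d) → 1ℤ ·ᵥ v +ᵥ 0ᵥ ≡ v
  1·ᵥ+0ᵥ [] = refl
  1·ᵥ+0ᵥ (x ∷ v) = cong₂ _∷_ (trans (ℤ.+-identityʳ _) (ℤ.*-identityˡ x)) (1·ᵥ+0ᵥ v)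

Grading : ∀ {d n} → Matrix d n → Pred (Vec ℤ d) 0ℓ
Grading A c = All (Positive c) (columns A)

Q-positive : ∀ {d n} (A : Matrix d n) {c} → c ∈ Grading A → Q A ⊆ Positive c
Q-positive {n = zero} A _ ([] , refl) = inj₁ (*ᵥ-[] A)
Q-positive {n = suc n} A {c} (pos ∷ rest) (m ∷ k , refl) =
  subst (Positive c) (sym (*ᵥ-∷ A (+ m) (map +_ k)))
    (positive-+ᵥ {c = c} (positive-·ᵥ {c = c} m pos) (Q-positive (map tail A) {c} rest (k , refl)))

-- Induction on the columns: a search over the multiplicity `m` of the first column, which the
-- degree `dot c x` bounds.
Q? : ∀ {d n} (A : Matrix d n) {c} → c ∈ Grading A → ∀ x → Dec (x ∈ Q A)
Q? {n = zero} A _ x = map′ ([] ,_) (λ { ([] , eq) → eq }) (x ≟ᵥ A *ℕ [])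
Q? {n = suc n} A {c} (pos ∷ rest) x =
  -- The search bound is exclusive, hence the `suc`.
  map′ to (from pos) (ℕ.anyUpTo? (λ m → Q? (map tail A) {c} rest (x -ᵥ + m ·ᵥ map head A)) (suc ℤ.∣ dot c x ∣))
  where
  a = map head A
  T = map tail A

  to : (∃ λ m → m ℕ.< suc ℤ.∣ dot c x ∣ × x -ᵥ + m ·ᵥ a ∈ Q T) → x ∈ Q A
  to (m , _ , y∈Q) = subst (_∈ Q A) (+ᵥ--ᵥ-split (+ m ·ᵥ a) x) (Q-cons A m y∈Q)

  from : a ∈ Positive c → x ∈ Q A → ∃ λ m → m ℕ.< suc ℤ.∣ dot c x ∣ × x -ᵥ + m ·ᵥ a ∈ Q T
  -- A zero column contributes nothing, so its multiplicity may be reset to 0.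
  from (inj₁ a≡0) (m ∷ k , refl) = 0 , ℕ.s≤s ℕ.z≤n , k ,
    trans (cong₂ _-ᵥ_ (*ᵥ-∷ A (+ m) (map +_ k)) 0a≡ma) (+ᵥ--ᵥ-cancel (+ m ·ᵥ a) (T *ℕ k))
    where
    0a≡ma : 0ℤ ·ᵥ a ≡ + m ·ᵥ a
    0a≡ma = trans (0·ᵥ a) (sym (trans (cong (+ m ·ᵥ_) a≡0) (·ᵥ-0ᵥ (+ m))))
  from (inj₂ 0<ca) (m ∷ k , refl) = m , ℕ.s≤s (ℤ.drop‿+≤+ bound) , k ,
    trans (cong (_-ᵥ + m ·ᵥ a) (*ᵥ-∷ A (+ m) (map +_ k))) (+ᵥ--ᵥ-cancel (+ m ·ᵥ a) (T *ℕ k))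
    where
    0≤cy : 0ℤ ℤ.≤ dot c (T *ℕ k)
    0≤cy = positive⇒0≤dot {c = c} (Q-positive T {c} rest (k , refl))

    -- Each copy of the first column has degree at least 1, and the remaining columns have
    -- nonnegative total degree.
    m≤cx : + m ℤ.≤ dot c (A *ℕ (m ∷ k))
    m≤cx = begin
      + m                                   ≡⟨ trans (cong (ℤ._+ 0ℤ) (ℤ.*-identityʳ (+ m))) (ℤ.+-identityʳ (+ m)) ⟨
      + m ℤ.* 1ℤ ℤ.+ 0ℤ                     ≤⟨ ℤ.+-mono-≤ (ℤ.*-monoˡ-≤-nonNeg (+ m) (ℤ.i<j⇒suc[i]≤j 0<ca)) 0≤cy ⟩
      + m ℤ.* dot c a ℤ.+ dot c (T *ℕ k)    ≡⟨ dot-*ᵥ-∷ c A (+ m) (map +_ k) ⟨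
      dot c (A *ℕ (m ∷ k))                  ∎
      where open ℤ.≤-Reasoning

    bound : + m ℤ.≤ + ℤ.∣ dot c (A *ℕ (m ∷ k)) ∣
    bound = ℤ.≤-trans m≤cx
      (ℤ.≤-reflexive (sym (ℤ.0≤i⇒+∣i∣≡i (ℤ.≤-trans (ℤ.+≤+ ℕ.z≤n) m≤cx))))

-- Real cones

module Linearℚ = Linear ℚ.+-*-rawSemiring
module Dotℚ = DotProperties (CommutativeRing.commutativeSemiring ℚ.+-*-commutativeRing)

-- The constant term of the sequence `fromℤ z`.
ι : ℤ → ℚ
ι z = z ℚ./ 1

-- Unnormalised rationals avoid the gcd hidden in `z ℚ./ 1`, so the homomorphism laws reduce to
-- integer arithmetic.
toℚᵘ-ι : ∀ z → ℚ.toℚᵘ (ι z) ℚᵘ.≃ mkℚᵘ z 0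
toℚᵘ-ι z = ℚ.toℚᵘ-fromℚᵘ (mkℚᵘ z 0)

ι-+ : ∀ x y → ι (x ℤ.+ y) ≡ ι x ℚ.+ ι y
ι-+ x y = ℚ.toℚᵘ-injective (begin-equality
  ℚ.toℚᵘ (ι (x ℤ.+ y))                  ≃⟨ toℚᵘ-ι (x ℤ.+ y) ⟩
  mkℚᵘ (x ℤ.+ y) 0                      ≡⟨ cong (λ z → mkℚᵘ z 0) (cong₂ ℤ._+_ (ℤ.*-identityʳ x) (ℤ.*-identityʳ y)) ⟨
  mkℚᵘ x 0 ℚᵘ.+ mkℚᵘ y 0                ≃⟨ ℚᵘ.+-cong (toℚᵘ-ι x) (toℚᵘ-ι y) ⟨
  ℚ.toℚᵘ (ι x) ℚᵘ.+ ℚ.toℚᵘ (ι y)        ≃⟨ ℚ.toℚᵘ-homo-+ (ι x) (ι y) ⟨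
  ℚ.toℚᵘ (ι x ℚ.+ ι y)                  ∎)
  where open ℚᵘ.≤-Reasoning

ι-* : ∀ x y → ι (x ℤ.* y) ≡ ι x ℚ.* ι y
ι-* x y = ℚ.toℚᵘ-injective (begin-equality
  ℚ.toℚᵘ (ι (x ℤ.* y))                  ≃⟨ toℚᵘ-ι (x ℤ.* y) ⟩
  mkℚᵘ x 0 ℚᵘ.* mkℚᵘ y 0                ≃⟨ ℚᵘ.*-cong (toℚᵘ-ι x) (toℚᵘ-ι y) ⟨
  ℚ.toℚᵘ (ι x) ℚᵘ.* ℚ.toℚᵘ (ι y)        ≃⟨ ℚ.toℚᵘ-homo-* (ι x) (ι y) ⟨
  ℚ.toℚᵘ (ι x ℚ.* ι y)                  ∎)
  where open ℚᵘ.≤-Reasoning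

0≤ι⇒0≤ : ∀ z → 0ℚ ℚ.≤ ι z → 0ℤ ℤ.≤ z
0≤ι⇒0≤ z 0≤ιz with ℚᵘ.≤-trans (ℚ.toℚᵘ-mono-≤ 0≤ιz) (ℚᵘ.≤-reflexive (toℚᵘ-ι z))
... | ℚᵘ.*≤* le = subst (0ℤ ℤ.≤_) (ℤ.*-identityʳ z) le

0≤ι : ∀ n → 0ℚ ℚ.≤ ι (+ n)
0≤ι n = ℚ.nonNegative⁻¹ (ι (+ n)) {{ℚ.normalize-nonNeg n 1}}

ι-opposite : ∀ x y → x ℤ.+ y ≡ 0ℤ → ι y ≡ ℚ.- ι x
ι-opposite x y x+y≡0 = begin
  ι y                          ≡⟨ cancel (ι x) (ι y) ⟩
  ℚ.- ι x ℚ.+ (ι x ℚ.+ ι y)    ≡⟨ cong (ℚ.- ι x ℚ.+_) (trans (sym (ι-+ x y)) (cong ι x+y≡0)) ⟩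
  ℚ.- ι x ℚ.+ 0ℚ               ≡⟨ ℚ.+-identityʳ (ℚ.- ι x) ⟩
  ℚ.- ι x                      ∎
  where
  open ≡-Reasoning
  cancel : ∀ p q → q ≡ ℚ.- p ℚ.+ (p ℚ.+ q)
  cancel = solve 2 (λ p q → q := :- p :+ (p :+ q)) refl
    where open ℚSolver.+-*-Solver

dot-ι : ∀ {n} (u v : Vec ℤ n) → ι (dot u v) ≡ Linearℚ.dot (map ι u) (map ι v)
dot-ι [] [] = refl
dot-ι (x ∷ u) (y ∷ v) = trans (ι-+ (x ℤ.* y) (dot u v)) (cong₂ ℚ._+_ (ι-* x y) (dot-ι u v))

map-head-map : ∀ {d n} (A : Matrix d (suc n)) → map head (map (map ι) A) ≡ map ι (map head A)
map-head-map [] = refl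
map-head-map ((x ∷ r) ∷ A) = cong (ι x ∷_) (map-head-map A)

map-tail-map : ∀ {d n} (A : Matrix d (suc n)) → map tail (map (map ι) A) ≡ map (map ι) (map tail A)
map-tail-map [] = refl
map-tail-map ((x ∷ r) ∷ A) = cong (map ι r ∷_) (map-tail-map A)

-- The lower limit of `f` is at least 0. For the sequence of a real `x` this is what `fromℚ 0ℚ ≤ x`
-- unfolds to, but no Cauchy witness is carried, so real inequalities follow from termwise
-- identities in ℚ.
record Nonneg (f : ℕ → ℚ) : Set where
  constructor nonneg
  field eventually : ∀ ε → 0ℚ ℚ.< ε → ∃ λ N → ∀ n → N ℕ.≤ n → 0ℚ ℚ.< f n ℚ.+ ε
open Nonneg

nonneg-resp : ∀ {f g} → (∀ n → f n ≡ g n) → Nonneg f → Nonneg g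
nonneg-resp {f} {g} f≗g nf = nonneg λ ε 0<ε → let N , h = eventually nf ε 0<ε in
  N , λ n N≤n → subst (λ z → 0ℚ ℚ.< z ℚ.+ ε) (f≗g n) (h n N≤n)

0≤⇒nonneg : ∀ {f} → (∀ n → 0ℚ ℚ.≤ f n) → Nonneg f
0≤⇒nonneg 0≤f = nonneg λ ε 0<ε → 0 , λ n _ → ℚ.+-mono-≤-< (0≤f n) 0<ε

nonneg-+ : ∀ {f g} → Nonneg f → Nonneg g → Nonneg (λ n → f n ℚ.+ g n)
nonneg-+ {f} {g} nf ng = nonneg λ ε 0<ε →
  let N₁ , h₁ = eventually nf (ε ℚ.* ½) (half ε 0<ε)
      N₂ , h₂ = eventually ng (ε ℚ.* ½) (half ε 0<ε)
  in N₁ ℕ.⊔ N₂ , λ n N≤n → subst (0ℚ ℚ.<_) (regroup (f n) (g n) ε)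
    (ℚ.+-mono-< (h₁ n (ℕ.≤-trans (ℕ.m≤m⊔n N₁ N₂) N≤n)) (h₂ n (ℕ.≤-trans (ℕ.m≤n⊔m N₁ N₂) N≤n)))
  where
  half : ∀ ε → 0ℚ ℚ.< ε → 0ℚ ℚ.< ε ℚ.* ½
  half ε 0<ε = subst (ℚ._< ε ℚ.* ½) (ℚ.*-zeroˡ ½) (ℚ.*-monoˡ-<-pos ½ 0<ε)

  regroup : ∀ a b ε → (a ℚ.+ ε ℚ.* ½) ℚ.+ (b ℚ.+ ε ℚ.* ½) ≡ (a ℚ.+ b) ℚ.+ ε
  regroup = solve 3 (λ a b ε → (a :+ ε :* con ½) :+ (b :+ ε :* con ½) := (a :+ b) :+ ε) refl
    where open ℚSolver.+-*-Solver

-- Repeated addition avoids dividing `ε` by `m`.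
nonneg-ℕ* : ∀ {f} m → Nonneg f → Nonneg (λ n → ι (+ m) ℚ.* f n)
nonneg-ℕ* {f} zero nf = 0≤⇒nonneg λ n → ℚ.≤-reflexive (sym (ℚ.*-zeroˡ (f n)))
nonneg-ℕ* {f} (suc m) nf = nonneg-resp step (nonneg-+ nf (nonneg-ℕ* m nf))
  where
  open ≡-Reasoning
  step : ∀ n → f n ℚ.+ ι (+ m) ℚ.* f n ≡ ι (+ suc m) ℚ.* f n
  step n = begin
    f n ℚ.+ ι (+ m) ℚ.* f n             ≡⟨ cong (ℚ._+ ι (+ m) ℚ.* f n) (ℚ.*-identityˡ (f n)) ⟨
    ι 1ℤ ℚ.* f n ℚ.+ ι (+ m) ℚ.* f n    ≡⟨ ℚ.*-distribʳ-+ (f n) (ι 1ℤ) (ι (+ m)) ⟨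
    (ι 1ℤ ℚ.+ ι (+ m)) ℚ.* f n          ≡⟨ cong (ℚ._* f n) (ι-+ 1ℤ (+ m)) ⟨
    ι (+ suc m) ℚ.* f n                 ∎

-- A negative `q` is refuted by the choice `ε = −q`.
nonneg-const : ∀ {q} → Nonneg (λ _ → q) → 0ℚ ℚ.≤ q
nonneg-const {q} nq = ℚ.≮⇒≥ λ q<0 → contra q<0 (eventually nq (ℚ.- q) (ℚ.neg-antimono-< q<0))
  where
  contra : q ℚ.< 0ℚ → ¬ (∃ λ N → ∀ n → N ℕ.≤ n → 0ℚ ℚ.< q ℚ.+ ℚ.- q)
  contra q<0 (N , h) = ℚ.<-irrefl (sym (ℚ.+-inverseʳ q)) (h N ℕ.≤-refl)

≈⇒nonneg : ∀ {x y} → x ≈ y → Nonneg (λ n → seq x n ℚ.- seq y n) × Nonneg (λ n → seq y n ℚ.- seq x n)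
≈⇒nonneg {x} {y} x≈y = below , above
  where
  bound : ∀ a b ε → ∣ a ℚ.- b ∣ ℚ.< ε → 0ℚ ℚ.< (a ℚ.- b) ℚ.+ ε
  bound a b ε close = begin-strict
    0ℚ                                 ≡⟨ ℚ.+-inverseʳ (a ℚ.- b) ⟨
    (a ℚ.- b) ℚ.+ ℚ.- (a ℚ.- b)        ≤⟨ ℚ.+-monoʳ-≤ (a ℚ.- b) (p≤∣p∣ (ℚ.- (a ℚ.- b))) ⟩
    (a ℚ.- b) ℚ.+ ∣ ℚ.- (a ℚ.- b) ∣    ≡⟨ cong ((a ℚ.- b) ℚ.+_) (ℚ.∣-p∣≡∣p∣ (a ℚ.- b)) ⟩
    (a ℚ.- b) ℚ.+ ∣ a ℚ.- b ∣          <⟨ ℚ.+-monoʳ-< (a ℚ.- b) close ⟩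
    (a ℚ.- b) ℚ.+ ε                    ∎
    where
    open ℚ.≤-Reasoning
    p≤∣p∣ : ∀ p → p ℚ.≤ ∣ p ∣
    p≤∣p∣ p with ℚ.≤-total 0ℚ p
    ... | inj₁ 0≤p = ℚ.≤-reflexive (sym (ℚ.0≤p⇒∣p∣≡p 0≤p))
    ... | inj₂ p≤0 = ℚ.≤-trans p≤0 (ℚ.0≤∣p∣ p)

  ∣-∣-swap : ∀ a b → ∣ a ℚ.- b ∣ ≡ ∣ b ℚ.- a ∣
  ∣-∣-swap a b = trans (sym (ℚ.∣-p∣≡∣p∣ (a ℚ.- b))) (cong ∣_∣ (neg-sub a b))
    where
    open ℚSolver.+-*-Solver
    neg-sub : ∀ a b → ℚ.- (a ℚ.- b) ≡ b ℚ.- a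
    neg-sub = solve 2 (λ a b → :- (a :- b) := b :- a) refl

  below : Nonneg (λ n → seq x n ℚ.- seq y n)
  below = nonneg λ ε 0<ε → let N , h = x≈y ε 0<ε in
    N , λ n N≤n → bound (seq x n) (seq y n) ε (h n N≤n)

  above : Nonneg (λ n → seq y n ℚ.- seq x n)
  above = nonneg λ ε 0<ε → let N , h = x≈y ε 0<ε in
    N , λ n N≤n → bound (seq y n) (seq x n) ε
      (subst (ℚ._< ε) (∣-∣-swap (seq x n) (seq y n)) (h n N≤n))

-- Real arithmetic is termwise, so taking the `m`-th term turns real linear algebra into rational
-- linear algebra.
at : ∀ {n} → ℕ → Vec ℝ n → Vec ℚ n
at m = map (λ x → seq x m)

seq-dot : ∀ {n} (u v : Vec ℝ n) m → seq (Linearℝ.dot u v) m ≡ Linearℚ.dot (at m u) (at m v)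
seq-dot [] [] m = refl
seq-dot (x ∷ u) (y ∷ v) m = cong (seq x m ℚ.* seq y m ℚ.+_) (seq-dot u v m)

at-toℝᵈ : ∀ {n} (u : Vec ℤ n) m → at m (toℝᵈ u) ≡ map ι u
at-toℝᵈ [] m = refl
at-toℝᵈ (x ∷ u) m = cong (ι x ∷_) (at-toℝᵈ u m)

at-*ᵥ : ∀ {d n} (A : Matrix d n) (k : Vec ℝ n) m →
  at m (map toℝᵈ A Linearℝ.*ᵥ k) ≡ map (map ι) A Linearℚ.*ᵥ at m k
at-*ᵥ [] k m = refl
at-*ᵥ (r ∷ A) k m = cong₂ _∷_
  (trans (seq-dot (toℝᵈ r) k m) (cong (λ v → Linearℚ.dot v (at m k)) (at-toℝᵈ r m)))
  (at-*ᵥ A k m)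

-- Both signs of the difference are controlled, hence also its multiple by an integer of either sign.
dot-≈-nonneg : ∀ {d} (c : Vec ℤ d) {xs ys : Vec ℝ d} → Pointwise _≈_ xs ys →
  Nonneg (λ m → Linearℚ.dot (map ι c) (at m xs) ℚ.- Linearℚ.dot (map ι c) (at m ys))
dot-≈-nonneg [] [] = 0≤⇒nonneg λ _ → ℚ.≤-refl
dot-≈-nonneg (z ∷ c) {x ∷ xs} {y ∷ ys} (x≈y ∷ xs≈ys) =
  nonneg-resp (λ m → regroup (ι z) (seq x m) (seq y m)
      (Linearℚ.dot (map ι c) (at m xs)) (Linearℚ.dot (map ι c) (at m ys)))
    (nonneg-+ (signed z) (dot-≈-nonneg c xs≈ys))
  where
  open ℚSolver.+-*-Solver
  regroup : ∀ z x y p q → z ℚ.* (x ℚ.- y) ℚ.+ (p ℚ.- q) ≡ (z ℚ.* x ℚ.+ p) ℚ.- (z ℚ.* y ℚ.+ q)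
  regroup = solve 5 (λ z x y p q → z :* (x :- y) :+ (p :- q) := (z :* x :+ p) :- (z :* y :+ q)) refl

  flip-sign : ∀ z x y → z ℚ.* (y ℚ.- x) ≡ (ℚ.- z) ℚ.* (x ℚ.- y)
  flip-sign = solve 3 (λ z x y → z :* (y :- x) := (:- z) :* (x :- y)) refl

  signed : ∀ z → Nonneg (λ m → ι z ℚ.* (seq x m ℚ.- seq y m))
  signed (+ n) = nonneg-ℕ* n (proj₁ (≈⇒nonneg {x} {y} x≈y))
  signed ℤ.-[1+ n ] = nonneg-resp (λ m → flip-sign (ι (+ suc n)) (seq x m) (seq y m))
    (nonneg-ℕ* (suc n) (proj₂ (≈⇒nonneg {x} {y} x≈y)))

-- The value is the sum of the weights in `k` times the degrees of the columns, and these degrees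
-- are nonnegative integers.
dot-cone-nonneg : ∀ {d n} (A : Matrix d n) {c} → c ∈ Grading A → {k : Vec ℝ n} → All (fromℚ 0ℚ ≤_) k →
  Nonneg (λ m → Linearℚ.dot (map ι c) (map (map ι) A Linearℚ.*ᵥ at m k))
dot-cone-nonneg {n = zero} A {c} _ [] =
  0≤⇒nonneg λ m → ℚ.≤-reflexive (sym (Dotℚ.dot-*ᵥ-[] (map ι c) (map (map ι) A)))
dot-cone-nonneg {n = suc n} A {c} (pos ∷ rest) {x ∷ k} (0≤x ∷ 0≤k) =
  -- The absolute value presents the nonnegative degree as a natural number, as `nonneg-ℕ*`
  -- requires.
  nonneg-resp eq (nonneg-+ (nonneg-ℕ* ℤ.∣ dot c a ∣ (nonneg 0≤x)) (dot-cone-nonneg T {c} rest 0≤k))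
  where
  open ≡-Reasoning
  a = map head A
  T = map tail A
  D = Linearℚ.dot (map ι c)

  eq : ∀ m → ι (+ ℤ.∣ dot c a ∣) ℚ.* seq x m ℚ.+ D (map (map ι) T Linearℚ.*ᵥ at m k)
    ≡ D (map (map ι) A Linearℚ.*ᵥ at m (x ∷ k))
  eq m = begin
    ι (+ ℤ.∣ dot c a ∣) ℚ.* seq x m ℚ.+ D (map (map ι) T Linearℚ.*ᵥ at m k)
      ≡⟨ cong₂ ℚ._+_
           (trans (ℚ.*-comm _ (seq x m)) (cong (seq x m ℚ.*_)
             (trans (cong ι (ℤ.0≤i⇒+∣i∣≡i (positive⇒0≤dot {c = c} pos)))
               (trans (dot-ι c a) (cong D (sym (map-head-map A)))))))
           (cong (λ M → D (M Linearℚ.*ᵥ at m k)) (sym (map-tail-map A))) ⟩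
    seq x m ℚ.* D (map head (map (map ι) A)) ℚ.+ D (map tail (map (map ι) A) Linearℚ.*ᵥ at m k)
      ≡⟨ Dotℚ.dot-*ᵥ-∷ (map ι c) (map (map ι) A) (seq x m) (at m k) ⟨
    D (map (map ι) A Linearℚ.*ᵥ at m (x ∷ k)) ∎

-- Adding the nonnegative value on `A k` to the difference caused by `x ≈ A k` leaves a constant
-- integer sequence, whose sign can be read off. This bounds the degrees of holes from below, so the
-- descent stops.
grading-cone : ∀ {d n} (A : Matrix d n) {c x} → c ∈ Grading A → toℝᵈ x ∈ cone A → 0ℤ ℤ.≤ dot c x
grading-cone A {c} {x} gr (k , 0≤k , x≈Ak) = 0≤ι⇒0≤ (dot c x) (nonneg-const
  (nonneg-resp eq (nonneg-+ (dot-≈-nonneg c x≈Ak) (dot-cone-nonneg A {c} gr 0≤k))))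
  where
  cancel : ∀ p q → (p ℚ.- q) ℚ.+ q ≡ p
  cancel = solve 2 (λ p q → (p :- q) :+ q := p) refl
    where open ℚSolver.+-*-Solver

  D = Linearℚ.dot (map ι c)

  eq : ∀ m → (D (at m (toℝᵈ x)) ℚ.- D (at m (map toℝᵈ A Linearℝ.*ᵥ k)))
    ℚ.+ D (map (map ι) A Linearℚ.*ᵥ at m k) ≡ ι (dot c x)
  eq m = trans
    (cong₂ (λ u v → (D u ℚ.- D v) ℚ.+ D (map (map ι) A Linearℚ.*ᵥ at m k)) (at-toℝᵈ x m) (at-*ᵥ A k m))
    (trans (cancel _ _) (sym (dot-ι c x)))

-- Lines in the cone and pointedness of `Q`

0≤p*p : ∀ p → 0ℚ ℚ.≤ p ℚ.* p
0≤p*p p with ℚ.≤-total 0ℚ p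
... | inj₁ 0≤p = subst (ℚ._≤ p ℚ.* p) (ℚ.*-zeroʳ p) (ℚ.*-monoˡ-≤-nonNeg p {{ℚ.nonNegative 0≤p}} 0≤p)
... | inj₂ p≤0 = subst (ℚ._≤ p ℚ.* p) (ℚ.*-zeroʳ p) (ℚ.*-monoˡ-≤-nonPos p {{ℚ.nonPositive p≤0}} p≤0)

0≤p*q : ∀ {p q} → 0ℚ ℚ.≤ p → 0ℚ ℚ.≤ q → 0ℚ ℚ.≤ p ℚ.* q
0≤p*q {p} {q} 0≤p 0≤q =
  subst (ℚ._≤ p ℚ.* q) (ℚ.*-zeroʳ p) (ℚ.*-monoˡ-≤-nonNeg p {{ℚ.nonNegative 0≤p}} 0≤q)

≡⇒≈ : ∀ {x y} → (∀ m → seq x m ≡ seq y m) → x ≈ y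
≡⇒≈ {x} {y} x≗y ε 0<ε = 0 , λ m _ → subst (ℚ._< ε)
  (sym (cong ∣_∣ (trans (cong (ℚ._- seq y m) (x≗y m)) (ℚ.+-inverseʳ (seq y m))))) 0<ε

-- t = square⁺ t − square t with both terms nonnegative, which avoids splitting on the sign of a real.
square⁺ square : ℝ → ℝ
square⁺ t = (t + fromℚ ½) * (t + fromℚ ½)
  where open RawSemiring ℝ-rawSemiring using (_+_; _*_)
square t = t * t + fromℚ (½ ℚ.* ½)
  where open RawSemiring ℝ-rawSemiring using (_+_; _*_)

-- If `A l` is the negative of `A k`, then `A` sends these nonnegative weights to `t` times `A k`.
lineWeights : ∀ {n} → ℝ → Vec ℕ n → Vec ℕ n → Vec ℝ n
lineWeights t k l =
  (square⁺ t Linearℝ.·ᵥ toℝᵈ (map +_ k)) Linearℝ.+ᵥ (square t Linearℝ.·ᵥ toℝᵈ (map +_ l))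

lineWeights-nonneg : ∀ {n} t (k l : Vec ℕ n) → All (fromℚ 0ℚ ≤_) (lineWeights t k l)
lineWeights-nonneg t [] [] = []
lineWeights-nonneg t (x ∷ k) (y ∷ l) =
  eventually (0≤⇒nonneg (λ m → ℚ.+-mono-≤
    (0≤p*q (0≤p*p (seq t m ℚ.+ ½)) (0≤ι x))
    (0≤p*q (ℚ.+-mono-≤ (0≤p*p (seq t m)) (ℚ.nonNegative⁻¹ (½ ℚ.* ½))) (0≤ι y))))
  ∷ lineWeights-nonneg t k l

dot-lineWeights : ∀ {n} (r : Vec ℤ n) t k l m →
  seq (Linearℝ.dot (toℝᵈ r) (lineWeights t k l)) m ≡
  seq (square⁺ t) m ℚ.* ι (dot r (map +_ k)) ℚ.+ seq (square t) m ℚ.* ι (dot r (map +_ l))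
dot-lineWeights [] t [] [] m = sym (cong₂ ℚ._+_ (ℚ.*-zeroʳ (seq (square⁺ t) m)) (ℚ.*-zeroʳ (seq (square t) m)))
dot-lineWeights (z ∷ r) t (x ∷ k) (y ∷ l) m = begin
  ι z ℚ.* (p ℚ.* ι (+ x) ℚ.+ q ℚ.* ι (+ y)) ℚ.+ seq (Linearℝ.dot (toℝᵈ r) (lineWeights t k l)) m
    ≡⟨ cong (ι z ℚ.* (p ℚ.* ι (+ x) ℚ.+ q ℚ.* ι (+ y)) ℚ.+_) (dot-lineWeights r t k l m) ⟩
  ι z ℚ.* (p ℚ.* ι (+ x) ℚ.+ q ℚ.* ι (+ y)) ℚ.+ (p ℚ.* ι (dot r (map +_ k)) ℚ.+ q ℚ.* ι (dot r (map +_ l)))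
    ≡⟨ regroup (ι z) p q (ι (+ x)) (ι (+ y)) _ _ ⟩
  p ℚ.* (ι z ℚ.* ι (+ x) ℚ.+ ι (dot r (map +_ k))) ℚ.+ q ℚ.* (ι z ℚ.* ι (+ y) ℚ.+ ι (dot r (map +_ l)))
    ≡⟨ cong₂ (λ a b → p ℚ.* a ℚ.+ q ℚ.* b) (unfold x k) (unfold y l) ⟨
  p ℚ.* ι (dot (z ∷ r) (+ x ∷ map +_ k)) ℚ.+ q ℚ.* ι (dot (z ∷ r) (+ y ∷ map +_ l)) ∎
  where
  open ≡-Reasoning
  p q : ℚ
  p = seq (square⁺ t) m
  q = seq (square t) m

  unfold : ∀ x k → ι (dot (z ∷ r) (+ x ∷ map +_ k)) ≡ ι z ℚ.* ι (+ x) ℚ.+ ι (dot r (map +_ k))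
  unfold x k = trans (ι-+ (z ℤ.* + x) (dot r (map +_ k))) (cong (ℚ._+ _) (ι-* z (+ x)))

  regroup : ∀ z p q x y a b → z ℚ.* (p ℚ.* x ℚ.+ q ℚ.* y) ℚ.+ (p ℚ.* a ℚ.+ q ℚ.* b)
    ≡ p ℚ.* (z ℚ.* x ℚ.+ a) ℚ.+ q ℚ.* (z ℚ.* y ℚ.+ b)
  regroup = solve 7 (λ z p q x y a b → z :* (p :* x :+ q :* y) :+ (p :* a :+ q :* b)
    := p :* (z :* x :+ a) :+ q :* (z :* y :+ b)) refl
    where open ℚSolver.+-*-Solver

-- An element of `Q` with an additive inverse in `Q` spans a line through the origin inside the
-- cone, parametrised by `lineWeights`.
line∈cone : ∀ {d n} (A : Matrix d n) k l → A *ℕ k +ᵥ A *ℕ l ≡ 0ᵥ →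
  ∀ t → (replicate d (fromℚ 0ℚ) Linearℝ.+ᵥ t Linearℝ.·ᵥ toℝᵈ (A *ℕ k)) ∈ cone A
line∈cone A k l Ak+Al≡0 t = lineWeights t k l , lineWeights-nonneg t k l , rows A Ak+Al≡0
  where
  regroup : ∀ t a → 0ℚ ℚ.+ t ℚ.* a ≡
    (t ℚ.+ ½) ℚ.* (t ℚ.+ ½) ℚ.* a ℚ.+ (t ℚ.* t ℚ.+ ½ ℚ.* ½) ℚ.* (ℚ.- a)
  regroup = solve 2 (λ t a → con 0ℚ :+ t :* a :=
    (t :+ con ½) :* (t :+ con ½) :* a :+ (t :* t :+ con ½ :* con ½) :* (:- a)) refl
    where open ℚSolver.+-*-Solver

  open RawSemiring ℝ-rawSemiring using (_+_; _*_)

  rows : ∀ {d} (A : Matrix d _) → A *ℕ k +ᵥ A *ℕ l ≡ 0ᵥ →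
    Pointwise _≈_ (replicate d (fromℚ 0ℚ) Linearℝ.+ᵥ t Linearℝ.·ᵥ toℝᵈ (A *ℕ k))
      (map toℝᵈ A Linearℝ.*ᵥ lineWeights t k l)
  rows [] eq = []
  rows (r ∷ A) eq = ≡⇒≈ {fromℚ 0ℚ + t * fromℤ (dot r (map +_ k))}
      {Linearℝ.dot (toℝᵈ r) (lineWeights t k l)} (λ m → trans
      (trans (regroup (seq t m) (ι (dot r (map +_ k))))
        (cong (λ q → seq (square⁺ t) m ℚ.* ι (dot r (map +_ k)) ℚ.+ seq (square t) m ℚ.* q)
          (sym (ι-opposite (dot r (map +_ k)) (dot r (map +_ l)) (∷-injectiveˡ eq)))))
      (sym (dot-lineWeights r t k l m)))
    ∷ rows A (∷-injectiveʳ eq)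

toℝᵈ-≈0 : ∀ {d} (v : Vec ℤ d) → Pointwise _≈_ (toℝᵈ v) (replicate d (fromℚ 0ℚ)) → v ≡ 0ᵥ
toℝᵈ-≈0 [] [] = refl
toℝᵈ-≈0 (x ∷ v) (x≈0 ∷ v≈0) = cong₂ _∷_ (ℤ.≤-antisym x≤0 0≤x) (toℝᵈ-≈0 v v≈0)
  where
  0≤x : 0ℤ ℤ.≤ x
  0≤x = 0≤ι⇒0≤ x (subst (0ℚ ℚ.≤_) (ℚ.+-identityʳ (ι x))
    (nonneg-const (proj₁ (≈⇒nonneg {fromℤ x} {fromℚ 0ℚ} x≈0))))

  x≤0 : x ℤ.≤ 0ℤ
  x≤0 = ℤ.neg-cancel-≤ (0≤ι⇒0≤ (ℤ.- x) (subst (0ℚ ℚ.≤_)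
    (trans (ℚ.+-identityˡ (ℚ.- ι x)) (sym (ι-opposite x (ℤ.- x) (ℤ.+-inverseʳ x))))
    (nonneg-const (proj₂ (≈⇒nonneg {fromℤ x} {fromℚ 0ℚ} x≈0)))))

Q-pointed : ∀ {d n} (A : Matrix d n) → Pointed (cone A) →
  ∀ {u v} → u ∈ Q A → v ∈ Q A → u +ᵥ v ≡ 0ᵥ → u ≡ 0ᵥ
-- Pointedness only refutes `u ≢ 0ᵥ`; decidable equality of integer vectors removes the double
-- negation.
Q-pointed A pointed {u} (k , refl) (l , refl) eq = decidable-stable (u ≟ᵥ 0ᵥ) λ u≢0 →
  pointed (_ , toℝᵈ u , (λ u≈0 → u≢0 (toℝᵈ-≈0 u u≈0)) , line∈cone A k l eq)

grading : ∀ {d n} (A : Matrix d n) → Pointed (cone A) → ∃ (Grading A)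
grading {n = n} A pointed = gordan n (columns∈Q A)
  where open Gordan (Q A) (Q-+ᵥ A) (Q-·ᵥ A) (Q-pointed A pointed)

-- Monomial ideals

infixl 6 _+ₑ_
_+ₑ_ : ∀ {n} → Vec ℕ n → Vec ℕ n → Vec ℕ n
_+ₑ_ = zipWith ℕ._+_

infix 4 _≟ₑ_
_≟ₑ_ : ∀ {n} (k l : Vec ℕ n) → Dec (k ≡ l)
_≟ₑ_ = ≡-dec ℕ._≟_

+ₑ-cancelˡ : ∀ {n} (k : Vec ℕ n) {l m} → k +ₑ l ≡ k +ₑ m → l ≡ m
+ₑ-cancelˡ [] {[]} {[]} _ = refl
+ₑ-cancelˡ (x ∷ k) {y ∷ l} {z ∷ m} eq =
  cong₂ _∷_ (ℕ.+-cancelˡ-≡ x y z (∷-injectiveˡ eq)) (+ₑ-cancelˡ k (∷-injectiveʳ eq))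

-- Truncated subtraction gives the only possible cofactor, so divisibility of monomials is one
-- equality test.
+ₑ-factor? : ∀ {n} (k m : Vec ℕ n) → Dec (∃ λ l → m ≡ k +ₑ l)
+ₑ-factor? k m = map′ (λ eq → zipWith ℕ._∸_ m k , eq)
  (λ { (l , refl) → cong (k +ₑ_) (sym (+ₑ-∸ k l)) }) (m ≟ₑ (k +ₑ zipWith ℕ._∸_ m k))
  where
  +ₑ-∸ : ∀ {n} (k l : Vec ℕ n) → zipWith ℕ._∸_ (k +ₑ l) k ≡ l
  +ₑ-∸ [] [] = refl
  +ₑ-∸ (x ∷ k) (y ∷ l) = cong₂ _∷_ (ℕ.m+n∸m≡n x y) (+ₑ-∸ k l)

coeff-+ₚ : ∀ {n} (p q : Poly n) m → coeff (p +ₚ q) m ≡ coeff p m ℚ.+ coeff q m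
coeff-+ₚ [] q m = sym (ℚ.+-identityˡ (coeff q m))
coeff-+ₚ ((c , k) ∷ p) q m = trans (cong (c₀ ℚ.+_) (coeff-+ₚ p q m))
  (sym (ℚ.+-assoc c₀ (coeff p m) (coeff q m)))
  where
  c₀ = if ⌊ ≡-dec ℕ._≟_ k m ⌋ then c else 0ℚ

coeff-x^-self : ∀ {n} (k : Vec ℕ n) → coeff (x^ k) k ≢ 0ℚ
coeff-x^-self k with k ≟ₑ k
... | yes _ = λ ()
... | no k≢k = ⊥-elim (k≢k refl)

coeff-x^-support : ∀ {n} (k m : Vec ℕ n) → coeff (x^ k) m ≢ 0ℚ → k ≡ m
coeff-x^-support k m nz with k ≟ₑ m
... | yes eq = eq
... | no _ = ⊥-elim (nz refl)

+≢0 : ∀ p q → p ℚ.+ q ≢ 0ℚ → p ≢ 0ℚ ⊎ q ≢ 0ℚ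
+≢0 p q p+q≢0 with p ℚ.≟ 0ℚ
... | no p≢0 = inj₁ p≢0
... | yes refl = inj₂ (p+q≢0 ∘ trans (ℚ.+-identityˡ q))

-- The block that one term of the left factor contributes when `_*ₚ_` unfolds.
monomial* : ∀ {n} → ℚ × Vec ℕ n → Poly n → Poly n
monomial* (a , k) = List.map λ (b , l) → a ℚ.* b , k +ₑ l

coeff-monomial* : ∀ {n} a (k : Vec ℕ n) p l → coeff (monomial* (a , k) p) (k +ₑ l) ≡ a ℚ.* coeff p l
coeff-monomial* a k [] l = sym (ℚ.*-zeroʳ a)
coeff-monomial* a k ((b , l′) ∷ p) l with (k +ₑ l′) ≟ₑ (k +ₑ l) | l′ ≟ₑ l
... | yes _ | yes _ = trans (cong (a ℚ.* b ℚ.+_) (coeff-monomial* a k p l)) (sym (ℚ.*-distribˡ-+ a b (coeff p l)))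
... | no ≢ | yes eq = ⊥-elim (≢ (cong (k +ₑ_) eq))
... | yes eq | no ≢ = ⊥-elim (≢ (+ₑ-cancelˡ k eq))
... | no _ | no _ = begin
  0ℚ ℚ.+ coeff (monomial* (a , k) p) (k +ₑ l)   ≡⟨ cong (0ℚ ℚ.+_) (coeff-monomial* a k p l) ⟩
  0ℚ ℚ.+ a ℚ.* coeff p l                        ≡⟨ cong (ℚ._+ a ℚ.* coeff p l) (ℚ.*-zeroʳ a) ⟨
  a ℚ.* 0ℚ ℚ.+ a ℚ.* coeff p l                  ≡⟨ ℚ.*-distribˡ-+ a 0ℚ (coeff p l) ⟨
  a ℚ.* (0ℚ ℚ.+ coeff p l)                      ∎
  where open ≡-Reasoning

coeff-monomial*-outside : ∀ {n} a (k : Vec ℕ n) p m → ¬ (∃ λ l → m ≡ k +ₑ l) →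
  coeff (monomial* (a , k) p) m ≡ 0ℚ
coeff-monomial*-outside a k [] m _ = refl
coeff-monomial*-outside a k ((b , l) ∷ p) m ∄ with (k +ₑ l) ≟ₑ m
... | yes eq = ⊥-elim (∄ (l , sym eq))
... | no _ = trans (ℚ.+-identityˡ _) (coeff-monomial*-outside a k p m ∄)

monomial*-support : ∀ {n} t (p : Poly n) m → coeff (monomial* t p) m ≢ 0ℚ →
  ∃ λ l → m ≡ proj₂ t +ₑ l × coeff p l ≢ 0ℚ
monomial*-support (a , k) p m nz with +ₑ-factor? k m
... | no ∄ = ⊥-elim (nz (coeff-monomial*-outside a k p m ∄))
... | yes (l , refl) = l , refl , λ z →
  nz (trans (coeff-monomial* a k p l) (trans (cong (a ℚ.*_) z) (ℚ.*-zeroʳ a)))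

*ₚ-support : ∀ {n} (r p : Poly n) m → coeff (r *ₚ p) m ≢ 0ℚ →
  ∃ λ k → ∃ λ l → m ≡ k +ₑ l × coeff p l ≢ 0ℚ
*ₚ-support [] p m nz = ⊥-elim (nz refl)
*ₚ-support (t ∷ r) p m nz
  with +≢0 (coeff (monomial* t p) m) (coeff (r *ₚ p) m) (nz ∘ trans (coeff-+ₚ (monomial* t p) (r *ₚ p) m))
... | inj₁ nz′ = proj₂ t , monomial*-support t p m nz′
... | inj₂ nz′ = *ₚ-support r p m nz′

-- Polynomials supported in an upward closed set of exponents form an ideal. Support is read from
-- `coeff`, since lists of terms may contain cancelling entries.
monomialIdeal-support : ∀ {n} {Λ : Pred (Vec ℕ n) 0ℓ} {G : Pred (Poly n) 0ℓ} →
  (∀ k {l} → l ∈ Λ → k +ₑ l ∈ Λ) → (∀ {p} → p ∈ G → ∃ λ k → p ≡ x^ k × k ∈ Λ) →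
  ∀ {p} → p ∈ ⟨ G ⟩ → ∀ m → coeff p m ≢ 0ℚ → m ∈ Λ
monomialIdeal-support {Λ = Λ} {G} up gen = go
  where
  go : ∀ {p} → p ∈ ⟨ G ⟩ → ∀ m → coeff p m ≢ 0ℚ → m ∈ Λ
  go (generator p∈G) m nz with gen p∈G
  ... | k , refl , k∈Λ = subst Λ (coeff-x^-support k m nz) k∈Λ
  go zero∈ m nz = ⊥-elim (nz refl)
  go (+-closed {p} {q} p∈ q∈) m nz with +≢0 (coeff p m) (coeff q m) (nz ∘ trans (coeff-+ₚ p q m))
  ... | inj₁ nz′ = go p∈ m nz′
  ... | inj₂ nz′ = go q∈ m nz′
  go (*-closed r {p} p∈) m nz with *ₚ-support r p m nz
  ... | k , l , refl , nz′ = up k (go p∈ l nz′)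
  go (≋-closed p≋q p∈) m nz = go p∈ m (nz ∘ trans (sym (p≋q m)))

-- Saturation points

module _ {d n} (A : Matrix d n) where

  -- The exponents `l` with `f +ᵥ A *ℕ l` in `Q` are upward closed because `Q` is closed under
  -- addition, and `k` lies in the support of `x^ k`.
  monomial∈ideal⇒shift∈Q : ∀ f k → x^ k ∈ MonomialIdeal A f → f +ᵥ A *ℕ k ∈ Q A
  monomial∈ideal⇒shift∈Q f k x^k∈I =
    monomialIdeal-support {Λ = λ l → f +ᵥ A *ℕ l ∈ Q A} up
      (λ { (l , eq , _ , l∈Λ) → l , eq , l∈Λ }) x^k∈I k (coeff-x^-self k)
    where
    regroup : ∀ j l → (A *ℕ j) +ᵥ (f +ᵥ A *ℕ l) ≡ f +ᵥ A *ℕ (j +ₑ l)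
    regroup j l = begin
      A *ℕ j +ᵥ (f +ᵥ A *ℕ l)    ≡⟨ +ᵥ-comm (A *ℕ j) (f +ᵥ A *ℕ l) ⟩
      (f +ᵥ A *ℕ l) +ᵥ A *ℕ j    ≡⟨ +ᵥ-assoc f (A *ℕ l) (A *ℕ j) ⟩
      f +ᵥ (A *ℕ l +ᵥ A *ℕ j)    ≡⟨ cong (f +ᵥ_) (+ᵥ-comm (A *ℕ l) (A *ℕ j)) ⟩
      f +ᵥ (A *ℕ j +ᵥ A *ℕ l)    ≡⟨ cong (f +ᵥ_) (*ℕ-+ A j l) ⟨
      f +ᵥ A *ℕ (j +ₑ l)         ∎
      where open ≡-Reasoning

    up : ∀ j {l} → f +ᵥ A *ℕ l ∈ Q A → f +ᵥ A *ℕ (j +ₑ l) ∈ Q A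
    up j {l} l∈Λ = subst (_∈ Q A) (regroup j l) (Q-+ᵥ A (j , refl) l∈Λ)

  module _ {c} (c∈grading : c ∈ Grading A) {s} (s∈Q : s ∈ Q A)
    (s+f∈Q : ∀ {f} → FundamentalHole A f → s +ᵥ f ∈ Q A) where

    -- The conclusion is a negation, so "h is fundamental or not" needs no decision procedure.
    hole-descent : ∀ N {h} → dot c h ℤ.< + N → Hole A h → ¬ (s +ᵥ h ∉ Q A)
    hole-descent zero {h} ch<0 ((h∈cone , _) , _) _ =
      ℤ.<⇒≱ ch<0 (grading-cone A {c} {h} c∈grading h∈cone)
    -- If `s +ᵥ h` is not in `Q`, no smaller hole can exist, so `h` is fundamental and the
    -- hypothesis on `s` gives a contradiction.
    hole-descent (suc N) {h} ch<1+N h-hole s+h∉Q = s+h∉Q (s+f∈Q (h-hole , no-smaller))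
      where
      no-smaller : ¬ (∃ λ h′ → Hole A h′ × h′ ≢ h × (h -ᵥ h′) ∈ Q A)
      no-smaller (h′ , h′-hole , h′≢h , h-h′∈Q) =
        hole-descent N ch′<N h′-hole λ s+h′∈Q → s+h∉Q (subst (_∈ Q A) regroup (Q-+ᵥ A s+h′∈Q h-h′∈Q))
        where
        regroup : (s +ᵥ h′) +ᵥ (h -ᵥ h′) ≡ s +ᵥ h
        regroup = trans (+ᵥ-assoc s h′ (h -ᵥ h′)) (cong (s +ᵥ_) (+ᵥ--ᵥ-split h′ h))

        h-h′≢0 : h -ᵥ h′ ≢ 0ᵥ
        h-h′≢0 h-h′≡0 = h′≢h (begin
          h′                  ≡⟨ +ᵥ-identityˡ h′ ⟨
          0ᵥ +ᵥ h′            ≡⟨ +ᵥ-comm 0ᵥ h′ ⟩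
          h′ +ᵥ 0ᵥ            ≡⟨ cong (h′ +ᵥ_) h-h′≡0 ⟨
          h′ +ᵥ (h -ᵥ h′)     ≡⟨ +ᵥ--ᵥ-split h′ h ⟩
          h                   ∎)
          where open ≡-Reasoning

        0<c[h-h′] : 0ℤ ℤ.< dot c (h -ᵥ h′)
        0<c[h-h′] = positive⇒0<dot {c = c} h-h′≢0 (Q-positive A {c} c∈grading h-h′∈Q)

        -- The degree is an integer, so its strict drop is at least 1 and the bound decreases by
        -- one.
        ch′<N : dot c h′ ℤ.< + N
        ch′<N = ℤ.suc[i]≤j⇒i<j (begin
          1ℤ ℤ.+ dot c h′                      ≤⟨ ℤ.+-monoˡ-≤ (dot c h′) (ℤ.i<j⇒suc[i]≤j 0<c[h-h′]) ⟩
          dot c (h -ᵥ h′) ℤ.+ dot c h′         ≡⟨ ℤ.+-comm (dot c (h -ᵥ h′)) (dot c h′) ⟩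
          dot c h′ ℤ.+ dot c (h -ᵥ h′)         ≡⟨ dot-+ᵥ c h′ (h -ᵥ h′) ⟨
          dot c (h′ +ᵥ (h -ᵥ h′))              ≡⟨ cong (dot c) (+ᵥ--ᵥ-split h′ h) ⟩
          dot c h                              ≤⟨ ℤ.i<j⇒i≤pred[j] ch<1+N ⟩
          + N                                  ∎)
          where open ℤ.≤-Reasoning

    saturationPoint : SaturationPoint A s
    saturationPoint = s∈Q , λ { (q , q∈Qsat , refl) →
      -- As `s` lies in `Q`, failure of `s +ᵥ q` to lie in `Q` makes `q` a hole, which the descent
      -- refutes; decidability of `Q` turns this into membership.
      decidable-stable (Q? A {c} c∈grading (s +ᵥ q)) λ s+q∉Q →
        hole-descent (suc ℤ.∣ dot c q ∣) (bound (dot c q)) (q∈Qsat , s+q∉Q ∘ Q-+ᵥ A s∈Q) s+q∉Q }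
      where
      bound : ∀ i → i ℤ.< + suc ℤ.∣ i ∣
      bound (+ n) = ℤ.+<+ ℕ.≤-refl
      bound ℤ.-[1+ n ] = ℤ.-<+

-- The inclusions for both descriptions of the saturation points

module _ {d n} (A : Matrix d n) where

  hole-shift : ∀ {s} → SaturationPoint A s → ∀ {f} → FundamentalHole A f → f +ᵥ s ∈ Q A
  hole-shift {s} (_ , s+Qsat⊆Q) {f} ((f∈Qsat , _) , _) =
    subst (_∈ Q A) (+ᵥ-comm s f) (s+Qsat⊆Q (f , f∈Qsat , refl))

  S⊆⋂ : SaturationPoint A ⊆ Q A ∩ ⋂F A (λ f → ((f +ˢ Q A) ∩ Q A) -ˢ f)
  S⊆⋂ {s} s∈S = proj₁ s∈S , λ (f , f∈F) →
    f +ᵥ s , ((s , proj₁ s∈S , refl) , hole-shift s∈S f∈F) , sym (+ᵥ--ᵥ-cancel f s)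

  S⊆I : SaturationPoint A ⊆ (λ s → ∃ λ k → s ≡ A *ℕ k × (x^ k) ∈ ⋂F A (MonomialIdeal A))
  S⊆I s∈S@((k , refl) , _) = k , refl , λ (f , f∈F) →
    generator (k , refl , (_ , (k , refl) , refl) , hole-shift s∈S f∈F)

  module _ {c} (c∈grading : c ∈ Grading A) where

    ⋂⊆S : Q A ∩ ⋂F A (λ f → ((f +ˢ Q A) ∩ Q A) -ˢ f) ⊆ SaturationPoint A
    ⋂⊆S {s} (s∈Q , s∈⋂) = saturationPoint A {c} c∈grading s∈Q λ {f} f∈F → case f (s∈⋂ (f , f∈F))
      where
      case : ∀ f → s ∈ ((f +ˢ Q A) ∩ Q A) -ˢ f → s +ᵥ f ∈ Q A
      case f (x , (_ , x∈Q) , refl) = subst (_∈ Q A)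
        (sym (trans (+ᵥ-comm (x -ᵥ f) f) (+ᵥ--ᵥ-split f x))) x∈Q

    I⊆S : (λ s → ∃ λ k → s ≡ A *ℕ k × (x^ k) ∈ ⋂F A (MonomialIdeal A)) ⊆ SaturationPoint A
    I⊆S (k , refl , x^k∈I) = saturationPoint A {c} c∈grading (k , refl) λ {f} f∈F →
      subst (_∈ Q A) (+ᵥ-comm f (A *ℕ k)) (monomial∈ideal⇒shift∈Q A f k (x^k∈I (f , f∈F)))

theorem7p1 : ∀ {d n : ℕ} (A : Matrix d n) → Pointed (cone A) →
    (SaturationPoint A ≐ Q A ∩ ⋂F A (λ f → ((f +ˢ Q A) ∩ Q A) -ˢ f))
    × (SaturationPoint A ≐ (λ s → ∃ λ k → s ≡ A *ℕ k × (x^ k) ∈ ⋂F A (MonomialIdeal A)))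
theorem7p1 A pointed =
  let c , c∈grading = grading A pointed in
  (S⊆⋂ A , ⋂⊆S A {c} c∈grading) , (S⊆I A , I⊆S A {c} c∈grading)
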